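{- Let $L,M$ be terms of the CCV $\lambda\mu$-calculus with $L\to^* M$. (1) If $\Gamma\vdash L:T\mid\Delta$, then $\Gamma\vdash M:T\mid\Delta$. (2) If $\Gamma\vdash M:T\mid\Delta$, then there exist $\Gamma',\Delta',T'$ such that $\Gamma'\vdash L:T'\mid\Delta'$.
   Context: CCV $\lambda\mu$-calculus. Ordinary variables $x,y,z,\dots$ and continuation variables $k,l,\dots$ are disjoint. Terms $M ::= x \mid \lambda x.M \mid MM \mid (M\ \mathsf{where}\ x:=M) \mid \mu k.J$, jumps $J ::= [k]M \mid (J\ \mathsf{where}\ x:=M)$, where $(L\ \mathsf{where}\ x:=M)$ means $\mathsf{let}\ x=M\ \mathsf{in}\ L$ ($x$ bound in $L$ only). Terms are identified up to $\alpha$-conversion and the congruence generated by (E1) $(L\ \mathsf{where}\ x:=(M\ \mathsf{where}\ y:=N))=((L\ \mathsf{where}\ x:=M)\ \mathsf{where}\ y:=N)$ if $y$ not free in $L$; (E2) $((\mu k.J)\ \mathsf{where}\ x:=M)=\mu k.(J\ \mathsf{where}\ x:=M)$ if $k$ not free in $M$; (E3) $[k](L\ \mathsf{where}\ x:=M)=([k]L\ \mathsf{where}\ x:=M)$. Values $V$: variables and $\lambda$-abstractions; $N$ a non-value. Reduction rules ($z$ fresh): $NM\to(zM\ \mathsf{where}\ z:=N)$; $VN\to(Vz\ \mathsf{where}\ z:=N)$; $(\lambda x.M)V\to(M\ \mathsf{where}\ x:=V)$; $(M\ \mathsf{where}\ x:=V)\to M\{V/x\}$; $(M\ \mathsf{where}\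 x:=\mu k.J)\to\mu k.J\{[k]\square\mapsto[k](M\ \mathsf{where}\ x:=\square)\}$; $[l]\mu k.J\to J\{l/k\}$; $\lambda x.Vx\to V$ ($x$ not free in $V$); $(x\ \mathsf{where}\ x:=M)\to M$; $\mu k.[k]M\to M$ ($k$ not free in $M$); the context substitution replaces recursively each subjump $[k]Q$ with $k$ free by $[k](M\ \mathsf{where}\ x:=Q)$, and $J\{l/k\}$ replaces each such $[k]Q$ by $[l]Q$. $\to^*$ is the reflexive-transitive compatible closure. Types: raw $R ::= \alpha \mid S\rightarrow T$; subsidiary $S ::= \bigcap R$ (finite intersection, empty one $\omega$); types $T ::= \bigcup S$ (finite union, empty one $\mho$); modulo associativity/commutativity; raw types are one-element intersections, subsidiary types one-element unions. Subtyping: $\alpha\leq\alpha$; $S'\leq S$, $T\leq T'$ give $S\rightarrow T\leq S'\rightarrow T'$; $S\leq S'$ gives $S\cap S''\leq S'$; $S\leq S_i$ ($\forall i$) gives $S\leq\bigcap_iS_i$; $T\leq T'$ gives $T\leq T''\cup T'$; $T_i\leq T$ ($\forall i$) gives $\bigcup_iT_i\leq T$ (finite, possibly empty index sets). Judgements $\Gamma\vdash M:T\mid\Delta$ and $\Gamma\vdash J:\bot\mid\Delta$, where $\Gamma$ assigns subsidiary types to distinct ordinary variables, $\Delta$ assigns types to distinct continuation variables, and $\bot$ is a special type for jumps. Rules (index sets finite, possibly empty): $\Gamma,x:S\vdash x:S\mid\Delta$; if $\Gamma,x:S_i\vdash M:T_i\mid\Delta$ for all $i$ then $\Gamma\vdash\lambda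 x.M:\bigcap_i(S_i\rightarrow T_i)\mid\Delta$; if $\Gamma\vdash M:\bigcup_{i}\bigcap_{j\in J(i)}(S_{ij}\rightarrow T)\mid\Delta$ and $\Gamma\vdash N:\bigcup_{j\in J(i)}S_{ij}\mid\Delta$ for every $i$, then $\Gamma\vdash MN:T\mid\Delta$; if $\Gamma,x:S_i\vdash M:T\mid\Delta$ for all $i$ and $\Gamma\vdash N:\bigcup_iS_i\mid\Delta$ then $\Gamma\vdash(M\ \mathsf{where}\ x:=N):T\mid\Delta$; if $\Gamma\vdash J:\bot\mid\Delta,k:T$ then $\Gamma\vdash\mu k.J:T\mid\Delta$; if $\Gamma\vdash M:T\mid\Delta,k:T$ then $\Gamma\vdash[k]M:\bot\mid\Delta,k:T$; if $\Gamma,x:S_i\vdash J:\bot\mid\Delta$ for all $i$ and $\Gamma\vdash N:\bigcup_iS_i\mid\Delta$ then $\Gamma\vdash(J\ \mathsf{where}\ x:=N):\bot\mid\Delta$; if $\Gamma\vdash M:T\mid\Delta$ and $T\leq T'$ then $\Gamma\vdash M:T'\mid\Delta$.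
   Formalization: Γ and Δ are required to declare all free variables of L and M; without this part (1) fails: in the empty Γ, λw.xw has type ω by the empty index set, but its η-reduct x is untypable. -}

module Defs where

open import Data.Fin.Base using (Fin; zero; suc)
open import Data.Fin.Properties using (_≟_)
open import Data.List.Base using (List; [_]; _++_; concat; tabulate)
open import Data.List.Relation.Binary.Permutation.Homogeneous using (Permutation)
open import Data.Nat.Base using (ℕ; suc)
open import Data.Vec.Base using (Vec; _∷_; lookup)
open import Function.Base using (id; _∘_)
open import Level using (0ℓ)
open import Relation.Binary.Construct.Closure.ReflexiveTransitive using (Star)
open import Relation.Binary.Construct.Union using (_∪_)
open import Relation.Binary.Core using (Rel)
open import Relation.Nullary.Decidable.Core using (yes; no)
open import Relation.Nullary.Negation.Core using (¬_)

private
  variable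
    n n′ m m′ : ℕ

infixl 7 _·_
infix  6 _⟨≔_⟩ _⟨≔_⟩ᴶ
infix  5 ⟦_⟧_

-- Well-scoped de Bruijn syntax (so α-equivalent terms are equal), with n
-- ordinary and m continuation variables in scope.  L ⟨≔ M ⟩ is
-- (L where x := M), x being index zero of L, and ⟦ k ⟧ M is the jump [k]M.
data Term (n m : ℕ) : Set
data Jump (n m : ℕ) : Set

data Term n m where
  var    : Fin n → Term n m
  ƛ      : Term (suc n) m → Term n m
  _·_    : Term n m → Term n m → Term n m
  _⟨≔_⟩  : Term (suc n) m → Term n m → Term n m
  μ      : Jump n (suc m) → Term n m

data Jump n m where
  ⟦_⟧_   : Fin m → Term n m → Jump n m
  _⟨≔_⟩ᴶ : Jump (suc n) m → Term n m → Jump n m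

data Value {n m : ℕ} : Term n m → Set where
  var : ∀ x → Value (var x)
  ƛ   : ∀ M → Value (ƛ M)

lift : (Fin n → Fin n′) → Fin (suc n) → Fin (suc n′)
lift ρ zero    = zero
lift ρ (suc x) = suc (ρ x)

-- ρ renames ordinary variables, θ renames continuation variables.
ren  : (Fin n → Fin n′) → (Fin m → Fin m′) → Term n m → Term n′ m′
renᴶ : (Fin n → Fin n′) → (Fin m → Fin m′) → Jump n m → Jump n′ m′

ren ρ θ (var x)      = var (ρ x)
ren ρ θ (ƛ M)        = ƛ (ren (lift ρ) θ M)
ren ρ θ (M · N)      = ren ρ θ M · ren ρ θ N
ren ρ θ (L ⟨≔ M ⟩)   = ren (lift ρ) θ L ⟨≔ ren ρ θ M ⟩
ren ρ θ (μ J)        = μ (renᴶ ρ (lift θ) J)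

renᴶ ρ θ (⟦ k ⟧ M)    = ⟦ θ k ⟧ ren ρ θ M
renᴶ ρ θ (J ⟨≔ M ⟩ᴶ)  = renᴶ (lift ρ) θ J ⟨≔ ren ρ θ M ⟩ᴶ

wk : Term n m → Term (suc n) m
wk = ren suc id

wkᶜ : Term n m → Term n (suc m)
wkᶜ = ren id suc

-- Weakening by a variable placed just outside the innermost one.
wk₁ : Term (suc n) m → Term (suc (suc n)) m
wk₁ = ren (lift suc) id

wk₁ᴶ : Jump (suc n) m → Jump (suc (suc n)) m
wk₁ᴶ = renᴶ (lift suc) id

liftₛ : (Fin n → Term n′ m) → Fin (suc n) → Term (suc n′) m
liftₛ σ zero    = var zero
liftₛ σ (suc x) = wk (σ x)

sub  : (Fin n → Term n′ m) → Term n m → Term n′ m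
subᴶ : (Fin n → Term n′ m) → Jump n m → Jump n′ m

sub σ (var x)     = σ x
sub σ (ƛ M)       = ƛ (sub (liftₛ σ) M)
sub σ (M · N)     = sub σ M · sub σ N
sub σ (L ⟨≔ M ⟩)  = sub (liftₛ σ) L ⟨≔ sub σ M ⟩
sub σ (μ J)       = μ (subᴶ (wkᶜ ∘ σ) J)

subᴶ σ (⟦ k ⟧ M)   = ⟦ k ⟧ sub σ M
subᴶ σ (J ⟨≔ M ⟩ᴶ) = subᴶ (liftₛ σ) J ⟨≔ sub σ M ⟩ᴶ

infix 8 _[_/0] _[_/0]ᶜ

-- M{V/x}
_[_/0] : Term (suc n) m → Term n m → Term n m
M [ V /0] = sub (λ { zero → V ; (suc x) → var x }) M

-- J{l/k}
_[_/0]ᶜ : Jump n (suc m) → Fin m → Jump n m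
J [ l /0]ᶜ = renᴶ id (λ { zero → l ; (suc k) → k }) J

-- csubᴶ k M J is J{[k]□ ↦ [k](M where x := □)}, with x index zero of M.
csub  : Fin m → Term (suc n) m → Term n m → Term n m
csubᴶ : Fin m → Term (suc n) m → Jump n m → Jump n m

csub k M (var x)      = var x
csub k M (ƛ P)        = ƛ (csub k (wk₁ M) P)
csub k M (P · Q)      = csub k M P · csub k M Q
csub k M (P ⟨≔ Q ⟩)   = csub k (wk₁ M) P ⟨≔ csub k M Q ⟩
csub k M (μ J)        = μ (csubᴶ (suc k) (wkᶜ M) J)

csubᴶ k M (⟦ l ⟧ Q) with l ≟ k
... | yes _           = ⟦ l ⟧ (M ⟨≔ csub k M Q ⟩)
... | no  _           = ⟦ l ⟧ csub k M Q
csubᴶ k M (J ⟨≔ Q ⟩ᴶ) = csubᴶ k (wk₁ M) J ⟨≔ csub k M Q ⟩ᴶ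

-- Here and in the reductions, "not free in" is expressed by weakening.

infix 4 _≈_ _≈ᴶ_

data _≈_  {n m : ℕ} : Rel (Term n m) 0ℓ
data _≈ᴶ_ {n m : ℕ} : Rel (Jump n m) 0ℓ

data _≈_ {n} {m} where
  E1     : ∀ L M N → L ⟨≔ M ⟨≔ N ⟩ ⟩ ≈ (wk₁ L ⟨≔ M ⟩) ⟨≔ N ⟩
  E2     : ∀ J M → (μ J) ⟨≔ M ⟩ ≈ μ (J ⟨≔ wkᶜ M ⟩ᴶ)
  refl   : ∀ {M} → M ≈ M
  sym    : ∀ {M N} → M ≈ N → N ≈ M
  trans  : ∀ {L M N} → L ≈ M → M ≈ N → L ≈ N
  ƛ      : ∀ {M M′} → M ≈ M′ → ƛ M ≈ ƛ M′
  _·_    : ∀ {M M′ N N′} → M ≈ M′ → N ≈ N′ → M · N ≈ M′ · N′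
  _⟨≔_⟩  : ∀ {L L′ M M′} → L ≈ L′ → M ≈ M′ → L ⟨≔ M ⟩ ≈ L′ ⟨≔ M′ ⟩
  μ      : ∀ {J J′} → J ≈ᴶ J′ → μ J ≈ μ J′

data _≈ᴶ_ {n} {m} where
  E1     : ∀ J M N → J ⟨≔ M ⟨≔ N ⟩ ⟩ᴶ ≈ᴶ (wk₁ᴶ J ⟨≔ M ⟩ᴶ) ⟨≔ N ⟩ᴶ
  E3     : ∀ k L M → ⟦ k ⟧ (L ⟨≔ M ⟩) ≈ᴶ (⟦ k ⟧ L) ⟨≔ M ⟩ᴶ
  refl   : ∀ {J} → J ≈ᴶ J
  sym    : ∀ {J K} → J ≈ᴶ K → K ≈ᴶ J
  trans  : ∀ {I J K} → I ≈ᴶ J → J ≈ᴶ K → I ≈ᴶ K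
  ⟦_⟧_   : ∀ k {M M′} → M ≈ M′ → ⟦ k ⟧ M ≈ᴶ ⟦ k ⟧ M′
  _⟨≔_⟩ᴶ : ∀ {J J′ M M′} → J ≈ᴶ J′ → M ≈ M′ → J ⟨≔ M ⟩ᴶ ≈ᴶ J′ ⟨≔ M′ ⟩ᴶ

infix 4 _⟶_ _⟶ᴶ_ _⟶*_

data _⟶_  {n m : ℕ} : Rel (Term n m) 0ℓ
data _⟶ᴶ_ {n m : ℕ} : Rel (Jump n m) 0ℓ

data _⟶_ {n} {m} where
  ad₁   : ∀ {N M} → ¬ Value N → N · M ⟶ (var zero · wk M) ⟨≔ N ⟩
  ad₂   : ∀ {V N} → Value V → ¬ Value N → V · N ⟶ (wk V · var zero) ⟨≔ N ⟩
  βλ    : ∀ {M V} → Value V → ƛ M · V ⟶ M ⟨≔ V ⟩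
  βlet  : ∀ {M V} → Value V → M ⟨≔ V ⟩ ⟶ M [ V /0]
  βμ    : ∀ {M J} → M ⟨≔ μ J ⟩ ⟶ μ (csubᴶ zero (wkᶜ M) J)
  ηλ    : ∀ {V} → Value V → ƛ (wk V · var zero) ⟶ V
  ηlet  : ∀ {M} → var zero ⟨≔ M ⟩ ⟶ M
  ημ    : ∀ {M} → μ (⟦ zero ⟧ wkᶜ M) ⟶ M
  ξƛ    : ∀ {M M′} → M ⟶ M′ → ƛ M ⟶ ƛ M′
  ξ·ˡ   : ∀ {M M′ N} → M ⟶ M′ → M · N ⟶ M′ · N
  ξ·ʳ   : ∀ {M N N′} → N ⟶ N′ → M · N ⟶ M · N′
  ξ≔ˡ   : ∀ {L L′ M} → L ⟶ L′ → L ⟨≔ M ⟩ ⟶ L′ ⟨≔ M ⟩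
  ξ≔ʳ   : ∀ {L M M′} → M ⟶ M′ → L ⟨≔ M ⟩ ⟶ L ⟨≔ M′ ⟩
  ξμ    : ∀ {J J′} → J ⟶ᴶ J′ → μ J ⟶ μ J′

data _⟶ᴶ_ {n} {m} where
  βjmp  : ∀ {l J} → ⟦ l ⟧ μ J ⟶ᴶ J [ l /0]ᶜ
  ξjmp  : ∀ {k M M′} → M ⟶ M′ → ⟦ k ⟧ M ⟶ᴶ ⟦ k ⟧ M′
  ξ≔ˡ   : ∀ {J J′ M} → J ⟶ᴶ J′ → J ⟨≔ M ⟩ᴶ ⟶ᴶ J′ ⟨≔ M ⟩ᴶ
  ξ≔ʳ   : ∀ {J M M′} → M ⟶ M′ → J ⟨≔ M ⟩ᴶ ⟶ᴶ J ⟨≔ M′ ⟩ᴶ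

-- Terms are identified modulo _≈_, so congruence steps are free.
_⟶*_ : Rel (Term n m) 0ℓ
_⟶*_ = Star (_≈_ ∪ _⟶_)

infixr 7 _⇒_
infix  4 _≃ᴿ_ _≃_ _≤_

-- A subsidiary type is the list of the members of an intersection (ω is []),
-- a type the list of the members of a union (℧ is []).  Flat lists take care
-- of associativity; [_] embeds raw types in subsidiary types, and these in
-- types.
data Raw : Set where
  atom : ℕ → Raw
  _⇒_  : List Raw → List (List Raw) → Raw

Sub : Set
Sub = List Raw

Ty : Set
Ty = List Sub

-- Commutativity of ∩ and ∪, at every depth.
data _≃ᴿ_ : Rel Raw 0ℓ where
  atom : ∀ α → atom α ≃ᴿ atom α
  _⇒_  : ∀ {S S′ T T′} → Permutation _≃ᴿ_ S S′ →
         Permutation (Permutation _≃ᴿ_) T T′ → (S ⇒ T) ≃ᴿ (S′ ⇒ T′)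

_≃_ : Rel Ty 0ℓ
_≃_ = Permutation (Permutation _≃ᴿ_)

-- The rule conv accounts for the identification of types modulo _≃_.
data _≤_ : Rel Ty 0ℓ where
  atom : ∀ α → [ [ atom α ] ] ≤ [ [ atom α ] ]
  _⇒_  : ∀ {S S′ T T′} → [ S′ ] ≤ [ S ] → T ≤ T′ →
         [ [ S ⇒ T ] ] ≤ [ [ S′ ⇒ T′ ] ]
  ∩-l  : ∀ {S S′} S″ → [ S ] ≤ [ S′ ] → [ S ++ S″ ] ≤ [ S′ ]
  ∩-r  : ∀ {S i} (Sᵢ : Fin i → Sub) → (∀ a → [ S ] ≤ [ Sᵢ a ]) →
         [ S ] ≤ [ concat (tabulate Sᵢ) ]
  ∪-r  : ∀ {T T′} T″ → T ≤ T′ → T ≤ T″ ++ T′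
  ∪-l  : ∀ {T i} (Tᵢ : Fin i → Ty) → (∀ a → Tᵢ a ≤ T) →
         concat (tabulate Tᵢ) ≤ T
  conv : ∀ {T T₁ T₂ T′} → T ≃ T₁ → T₁ ≤ T₂ → T₂ ≃ T′ → T ≤ T′

infix 3 _⊢_∶_∣_ _⊢_∶⊥∣_

-- Contexts are total on the scope.  This matters because an empty family puts
-- no condition on a subterm: otherwise λw.xw would have type ω in the empty
-- context, unlike its reduct x.
-- No conversion rule modulo _≃_ is needed: it is an instance of ≤-sub for the
-- type of a term, and admissible for the types in the contexts.
data _⊢_∶_∣_ {n m : ℕ} (Γ : Vec Sub n) : Term n m → Ty → Vec Ty m → Set
data _⊢_∶⊥∣_ {n m : ℕ} (Γ : Vec Sub n) : Jump n m → Vec Ty m → Set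

data _⊢_∶_∣_ {n} {m} Γ where
  var   : ∀ {Δ} x → Γ ⊢ var x ∶ [ lookup Γ x ] ∣ Δ
  ƛ     : ∀ {Δ M i} (S : Fin i → Sub) (T : Fin i → Ty) →
          (∀ a → S a ∷ Γ ⊢ M ∶ T a ∣ Δ) →
          Γ ⊢ ƛ M ∶ [ tabulate (λ a → S a ⇒ T a) ] ∣ Δ
  app   : ∀ {Δ M N T i} (j : Fin i → ℕ) (S : ∀ a → Fin (j a) → Sub) →
          Γ ⊢ M ∶ tabulate (λ a → tabulate (λ b → S a b ⇒ T)) ∣ Δ →
          (∀ a → Γ ⊢ N ∶ tabulate (S a) ∣ Δ) →
          Γ ⊢ M · N ∶ T ∣ Δ
  let′  : ∀ {Δ M N T i} (S : Fin i → Sub) →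
          (∀ a → S a ∷ Γ ⊢ M ∶ T ∣ Δ) →
          Γ ⊢ N ∶ tabulate S ∣ Δ →
          Γ ⊢ M ⟨≔ N ⟩ ∶ T ∣ Δ
  μ     : ∀ {Δ J T} → Γ ⊢ J ∶⊥∣ T ∷ Δ → Γ ⊢ μ J ∶ T ∣ Δ
  ≤-sub : ∀ {Δ M T T′} → Γ ⊢ M ∶ T ∣ Δ → T ≤ T′ → Γ ⊢ M ∶ T′ ∣ Δ

data _⊢_∶⊥∣_ {n} {m} Γ where
  jump  : ∀ {Δ M} k → Γ ⊢ M ∶ lookup Δ k ∣ Δ → Γ ⊢ ⟦ k ⟧ M ∶⊥∣ Δ
  let′  : ∀ {Δ J N i} (S : Fin i → Sub) →
          (∀ a → S a ∷ Γ ⊢ J ∶⊥∣ Δ) →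
          Γ ⊢ N ∶ tabulate S ∣ Δ →
          Γ ⊢ J ⟨≔ N ⟩ᴶ ∶⊥∣ Δ

{-# OPTIONS --safe #-}
module Submission where

-- Inverting the typing rules turns typability into a predicate _⊩_∶_∣_ defined
-- by recursion on the term.  For it, each congruence axiom and each reduction
-- rule except ηλ is an equivalence.  The two substitution rules are inverted by
-- collecting the types at which the substituted object is used: intersections
-- for a value, since values are closed under intersection, and unions for a
-- continuation.  Only the expansion of V to λx.Vx can fail, namely when V has
-- an atomic type; after every atom in the derivation is replaced by ω → ℧ it
-- holds as well, which is why expansion changes the contexts and the type.

open import Defs
open import Data.Fin.Base using (Fin; zero; suc)
open import Data.Fin.Properties using (_≟_)
open import Data.List.Base using (List; []; _∷_; [_]; _++_; concat; tabulate; map; length)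
import Data.List.Base as List
open import Data.List.Membership.Propositional using (find; lose)
open import Data.List.Properties using (map-tabulate; tabulate-cong; tabulate-lookup)
open import Data.List.Membership.Propositional.Properties using (∈-lookup)
open import Data.List.Relation.Binary.Permutation.Homogeneous using (Permutation; refl; prep; swap; trans)
import Data.List.Relation.Binary.Permutation.Homogeneous as Permutation
open import Data.List.Relation.Binary.Permutation.Propositional using (↭⇒↭ₛ; ↭-sym)
open import Data.List.Relation.Binary.Permutation.Propositional.Properties using (∷↭∷ʳ)
open import Data.List.Relation.Binary.Pointwise using (Pointwise; []; _∷_)
open import Data.List.Relation.Binary.Subset.Propositional using (_⊆_)
open import Data.List.Relation.Binary.Subset.Propositional.Properties using (xs⊆xs++ys; xs⊆ys++xs)
open import Data.List.Relation.Unary.All using (All; []; _∷_)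
import Data.List.Relation.Unary.All as All
import Data.List.Relation.Unary.All.Properties as All
open import Data.List.Relation.Unary.Any using (Any; here; there)
import Data.List.Relation.Unary.Any as Any
import Data.List.Relation.Unary.Any.Properties as Any
open import Data.Nat.Base using (ℕ; suc)
open import Data.Product.Base using (_×_; _,_; ∃-syntax; Σ-syntax; proj₁; zip)
open import Data.Sum.Base using (inj₁; inj₂)
open import Data.Vec.Base using (Vec; []; _∷_; lookup; replicate; zipWith; _[_]≔_)
import Data.Vec.Base as Vec
open import Data.Vec.Properties using (lookup-map; lookup-replicate; lookup-zipWith; lookup∘update; lookup∘update′)
open import Data.Vec.Relation.Binary.Pointwise.Inductive using ([]; _∷_)
import Data.Vec.Relation.Binary.Pointwise.Inductive as Pointwiseⱽ
open import Function.Base using (id; _∘_; flip)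
open import Level using (0ℓ)
open import Relation.Binary.Construct.Closure.ReflexiveTransitive using (ε; _◅_)
open import Relation.Binary.Core using (Rel)
open import Relation.Binary.PropositionalEquality using (_≡_; refl; cong; cong₂; subst)
import Relation.Binary.PropositionalEquality as ≡
open import Relation.Nullary.Decidable.Core using (yes; no)

private
  variable
    n n′ m m′ : ℕ
    R R′ R₁ R₂ : Raw
    S S′ S₁ S₂ : Sub
    T T′ U U′ : Ty
    Γ Γ′ : Vec Sub n
    Δ Δ′ : Vec Ty m

-- Subtyping

infix 4 _≤ᴿ_ _≤ˢ_ _≤ᵀ_

-- A syntax-directed form of `_≤_`, inverted simply by matching. Lists are compared as sets of
-- members, so that `_≃_` is absorbed.
data _≤ᴿ_ : Rel Raw 0ℓ

_≤ˢ_ : Rel Sub 0ℓ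
S ≤ˢ S′ = All (λ R′ → Any (_≤ᴿ R′) S) S′

_≤ᵀ_ : Rel Ty 0ℓ
T ≤ᵀ T′ = All (λ S → Any (S ≤ˢ_) T′) T

data _≤ᴿ_ where
  atom : ∀ α → atom α ≤ᴿ atom α
  _⇒_  : S′ ≤ˢ S → T ≤ᵀ T′ → (S ⇒ T) ≤ᴿ (S′ ⇒ T′)

≤ᴿ-refl     : ∀ R → R ≤ᴿ R
≤ˢ-refl-All : ∀ S → All (λ R → R ≤ᴿ R) S
≤ᵀ-refl-All : ∀ T → All (λ S → S ≤ˢ S) T

-- Reflexivity of the members is a hypothesis because this is used inside the recursion that proves
-- reflexivity.
⊇-All⇒≤ˢ : S′ ⊆ S → All (λ R → R ≤ᴿ R) S′ → S ≤ˢ S′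
⊇-All⇒≤ˢ S′⊆S rs = All.tabulate λ R∈S′ → lose (S′⊆S R∈S′) (All.lookup rs R∈S′)

⊆-All⇒≤ᵀ : T ⊆ T′ → All (λ S → S ≤ˢ S) T → T ≤ᵀ T′
⊆-All⇒≤ᵀ T⊆T′ ss = All.tabulate λ S∈T → lose (T⊆T′ S∈T) (All.lookup ss S∈T)

≤ᴿ-refl (atom α) = atom α
≤ᴿ-refl (S ⇒ T)  = ⊇-All⇒≤ˢ id (≤ˢ-refl-All S) ⇒ ⊆-All⇒≤ᵀ id (≤ᵀ-refl-All T)

≤ˢ-refl-All []      = []
≤ˢ-refl-All (R ∷ S) = ≤ᴿ-refl R ∷ ≤ˢ-refl-All S

≤ᵀ-refl-All []      = []
≤ᵀ-refl-All (S ∷ T) = ⊇-All⇒≤ˢ id (≤ˢ-refl-All S) ∷ ≤ᵀ-refl-All T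

⊇⇒≤ˢ : S′ ⊆ S → S ≤ˢ S′
⊇⇒≤ˢ S′⊆S = ⊇-All⇒≤ˢ S′⊆S (≤ˢ-refl-All _)

⊆⇒≤ᵀ : T ⊆ T′ → T ≤ᵀ T′
⊆⇒≤ᵀ T⊆T′ = ⊆-All⇒≤ᵀ T⊆T′ (≤ᵀ-refl-All _)

≤ˢ-refl : S ≤ˢ S
≤ˢ-refl = ⊇⇒≤ˢ id

≤ᵀ-refl : T ≤ᵀ T
≤ᵀ-refl = ⊆⇒≤ᵀ id

-- The contravariant source of an arrow exchanges the two derivations, but both shrink there. The
-- helpers follow the chosen members, which keeps the recursion structural.
≤ᴿ-trans : R ≤ᴿ R₁ → R₁ ≤ᴿ R₂ → R ≤ᴿ R₂
≤ˢ-trans : S ≤ˢ S₁ → S₁ ≤ˢ S₂ → S ≤ˢ S₂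
≤ᵀ-trans : T ≤ᵀ T′ → T′ ≤ᵀ U → T ≤ᵀ U
≤ˢ-Any   : S ≤ˢ S′ → Any (_≤ᴿ R) S′ → Any (_≤ᴿ R) S
Any-≤ᴿ   : Any (_≤ᴿ R) S → R ≤ᴿ R′ → Any (_≤ᴿ R′) S
Any-≤ᵀ   : Any (S ≤ˢ_) T → T ≤ᵀ T′ → Any (S ≤ˢ_) T′
≤ˢ-Anyᵀ  : S ≤ˢ S′ → Any (S′ ≤ˢ_) T → Any (S ≤ˢ_) T

≤ᴿ-trans (atom α) (atom .α) = atom α
≤ᴿ-trans (s ⇒ t)  (s′ ⇒ t′) = ≤ˢ-trans s′ s ⇒ ≤ᵀ-trans t t′

≤ˢ-trans p []       = []
≤ˢ-trans p (q ∷ qs) = ≤ˢ-Any p q ∷ ≤ˢ-trans p qs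

≤ᵀ-trans []       q = []
≤ᵀ-trans (p ∷ ps) q = Any-≤ᵀ p q ∷ ≤ᵀ-trans ps q

≤ˢ-Any (p ∷ ps) (here q)  = Any-≤ᴿ p q
≤ˢ-Any (p ∷ ps) (there q) = ≤ˢ-Any ps q

Any-≤ᴿ (here p)  q = here (≤ᴿ-trans p q)
Any-≤ᴿ (there p) q = there (Any-≤ᴿ p q)

Any-≤ᵀ (here p)  (q ∷ qs) = ≤ˢ-Anyᵀ p q
Any-≤ᵀ (there p) (q ∷ qs) = Any-≤ᵀ p qs

≤ˢ-Anyᵀ p (here q)  = here (≤ˢ-trans p q)
≤ˢ-Anyᵀ p (there q) = there (≤ˢ-Anyᵀ p q)

≤ˢ⇒≤ᵀ : S ≤ˢ S′ → [ S ] ≤ᵀ [ S′ ]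
≤ˢ⇒≤ᵀ s = here s ∷ []

≤ᵀ⇒≤ˢ : [ S ] ≤ᵀ [ S′ ] → S ≤ˢ S′
≤ᵀ⇒≤ˢ (here s ∷ []) = s

∷-mono-≤ˢ : R ≤ᴿ R′ → S ≤ˢ S′ → R ∷ S ≤ˢ R′ ∷ S′
∷-mono-≤ˢ r s = here r ∷ All.map there s

∷-mono-≤ᵀ : S ≤ˢ S′ → T ≤ᵀ T′ → S ∷ T ≤ᵀ S′ ∷ T′
∷-mono-≤ᵀ s t = here s ∷ All.map there t

swap-mono-≤ˢ : R ≤ᴿ R′ → R₁ ≤ᴿ R₂ → S ≤ˢ S′ → R ∷ R₁ ∷ S ≤ˢ R₂ ∷ R′ ∷ S′
swap-mono-≤ˢ r r₁ s = there (here r₁) ∷ here r ∷ All.map (there ∘ there) s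

swap-mono-≤ᵀ : S ≤ˢ S′ → S₁ ≤ˢ S₂ → T ≤ᵀ T′ → S ∷ S₁ ∷ T ≤ᵀ S₂ ∷ S′ ∷ T′
swap-mono-≤ᵀ s s₁ t = there (here s) ∷ here s₁ ∷ All.map (there ∘ there) t

-- Both inequalities are proved at once because arrows are contravariant in
-- their source.
≃ᴿ⇒≤ᴿ : R ≃ᴿ R′ → R ≤ᴿ R′ × R′ ≤ᴿ R
≃ˢ⇒≤ˢ : Permutation _≃ᴿ_ S S′ → S ≤ˢ S′ × S′ ≤ˢ S
≋ˢ⇒≤ˢ : Pointwise _≃ᴿ_ S S′ → S ≤ˢ S′ × S′ ≤ˢ S
≃ᵀ⇒≤ᵀ : T ≃ T′ → T ≤ᵀ T′ × T′ ≤ᵀ T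
≋ᵀ⇒≤ᵀ : Pointwise (Permutation _≃ᴿ_) T T′ → T ≤ᵀ T′ × T′ ≤ᵀ T

≃ᴿ⇒≤ᴿ (atom α) = atom α , atom α
≃ᴿ⇒≤ᴿ (p ⇒ q) with ≃ˢ⇒≤ˢ p | ≃ᵀ⇒≤ᵀ q
... | s , s˘ | t , t˘ = s˘ ⇒ t , s ⇒ t˘

≃ˢ⇒≤ˢ (refl ps)     = ≋ˢ⇒≤ˢ ps
≃ˢ⇒≤ˢ (prep p ps)   = zip ∷-mono-≤ˢ ∷-mono-≤ˢ (≃ᴿ⇒≤ᴿ p) (≃ˢ⇒≤ˢ ps)
≃ˢ⇒≤ˢ (swap p q ps) with ≃ᴿ⇒≤ᴿ p | ≃ᴿ⇒≤ᴿ q | ≃ˢ⇒≤ˢ ps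
... | r , r˘ | r₁ , r₁˘ | s , s˘ = swap-mono-≤ˢ r r₁ s , swap-mono-≤ˢ r₁˘ r˘ s˘
≃ˢ⇒≤ˢ (trans p q)   = zip ≤ˢ-trans (flip ≤ˢ-trans) (≃ˢ⇒≤ˢ p) (≃ˢ⇒≤ˢ q)

≋ˢ⇒≤ˢ []       = [] , []
≋ˢ⇒≤ˢ (p ∷ ps) = zip ∷-mono-≤ˢ ∷-mono-≤ˢ (≃ᴿ⇒≤ᴿ p) (≋ˢ⇒≤ˢ ps)

≃ᵀ⇒≤ᵀ (refl ps)     = ≋ᵀ⇒≤ᵀ ps
≃ᵀ⇒≤ᵀ (prep p ps)   = zip ∷-mono-≤ᵀ ∷-mono-≤ᵀ (≃ˢ⇒≤ˢ p) (≃ᵀ⇒≤ᵀ ps)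
≃ᵀ⇒≤ᵀ (swap p q ps) with ≃ˢ⇒≤ˢ p | ≃ˢ⇒≤ˢ q | ≃ᵀ⇒≤ᵀ ps
... | s , s˘ | s₁ , s₁˘ | t , t˘ = swap-mono-≤ᵀ s s₁ t , swap-mono-≤ᵀ s₁˘ s˘ t˘
≃ᵀ⇒≤ᵀ (trans p q)   = zip ≤ᵀ-trans (flip ≤ᵀ-trans) (≃ᵀ⇒≤ᵀ p) (≃ᵀ⇒≤ᵀ q)

≋ᵀ⇒≤ᵀ []       = [] , []
≋ᵀ⇒≤ᵀ (p ∷ ps) = zip ∷-mono-≤ᵀ ∷-mono-≤ᵀ (≃ˢ⇒≤ˢ p) (≋ᵀ⇒≤ᵀ ps)

-- Each rule is admissible for the syntax-directed order, `conv` by transitivity. The converse is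
-- `≤ᵀ⇒≤`.
≤⇒≤ᵀ : T ≤ T′ → T ≤ᵀ T′
≤⇒≤ᵀ (atom α)      = ≤ᵀ-refl
≤⇒≤ᵀ (p ⇒ q)       = ≤ˢ⇒≤ᵀ (here (≤ᵀ⇒≤ˢ (≤⇒≤ᵀ p) ⇒ ≤⇒≤ᵀ q) ∷ [])
≤⇒≤ᵀ (∩-l S″ p)    = ≤ˢ⇒≤ᵀ (≤ˢ-trans (⊇⇒≤ˢ (xs⊆xs++ys _ S″)) (≤ᵀ⇒≤ˢ (≤⇒≤ᵀ p)))
≤⇒≤ᵀ (∩-r Sᵢ p)    = ≤ˢ⇒≤ᵀ (All.concat⁺ (All.tabulate⁺ λ a → ≤ᵀ⇒≤ˢ (≤⇒≤ᵀ (p a))))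
≤⇒≤ᵀ (∪-r T″ p)    = All.map (Any.++⁺ʳ T″) (≤⇒≤ᵀ p)
≤⇒≤ᵀ (∪-l Tᵢ p)    = All.concat⁺ (All.tabulate⁺ λ a → ≤⇒≤ᵀ (p a))
≤⇒≤ᵀ (conv p q p′) = ≤ᵀ-trans (proj₁ (≃ᵀ⇒≤ᵀ p)) (≤ᵀ-trans (≤⇒≤ᵀ q) (proj₁ (≃ᵀ⇒≤ᵀ p′)))

≃ᴿ-refl : ∀ R → R ≃ᴿ R
≋ˢ-refl : ∀ S → Pointwise _≃ᴿ_ S S
≋ᵀ-refl : ∀ T → Pointwise (Permutation _≃ᴿ_) T T

≃ᴿ-refl (atom α) = atom α
≃ᴿ-refl (S ⇒ T)  = refl (≋ˢ-refl S) ⇒ refl (≋ᵀ-refl T)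

≋ˢ-refl []      = []
≋ˢ-refl (R ∷ S) = ≃ᴿ-refl R ∷ ≋ˢ-refl S

≋ᵀ-refl []      = []
≋ᵀ-refl (S ∷ T) = refl (≋ˢ-refl S) ∷ ≋ᵀ-refl T

≃ˢ-refl : ∀ S → Permutation _≃ᴿ_ S S
≃ˢ-refl S = refl (≋ˢ-refl S)

≃-refl : ∀ T → T ≃ T
≃-refl T = refl (≋ᵀ-refl T)

-- The rules `∩-r` and `∪-l` speak of concatenated families; an arbitrary list enters them as the
-- family of its singletons.
concat-singletons : {A : Set} (xs : List A) → concat (tabulate ([_] ∘ List.lookup xs)) ≡ xs
concat-singletons []       = refl
concat-singletons (x ∷ xs) = cong (x ∷_) (concat-singletons xs)

-- `∩-l` discards a suffix, so `conv` first rotates the unwanted head to the end.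
∩-l-∷ : ∀ R → [ S ] ≤ [ S′ ] → [ R ∷ S ] ≤ [ S′ ]
∩-l-∷ {S} {S′} R p = conv
  (prep (Permutation.map (λ { refl → ≃ᴿ-refl _ }) (↭⇒↭ₛ (∷↭∷ʳ R S))) (refl []))
  (∩-l [ R ] p) (≃-refl _)

∪-r-∷ : ∀ T′ → T ≤ [ S ] → T ≤ S ∷ T′
∪-r-∷ {S = S} T′ p = conv (≃-refl _) (∪-r T′ p)
  (Permutation.map (λ { refl → ≃ˢ-refl _ }) (↭⇒↭ₛ (↭-sym (∷↭∷ʳ S T′))))

≤ᴿ⇒≤       : R ≤ᴿ R′ → [ [ R ] ] ≤ [ [ R′ ] ]
≤ˢ⇒≤       : S ≤ˢ S′ → [ S ] ≤ [ S′ ]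
≤ᵀ⇒≤       : T ≤ᵀ T′ → T ≤ T′
Any-≤ᴿ⇒≤   : Any (_≤ᴿ R) S → [ S ] ≤ [ [ R ] ]
Any-≤ˢ⇒≤   : Any (S ≤ˢ_) T → [ S ] ≤ T
≤ˢ-lookup  : S ≤ˢ S′ → ∀ a → [ S ] ≤ [ [ List.lookup S′ a ] ]
≤ᵀ-lookup  : T ≤ᵀ T′ → ∀ a → [ List.lookup T a ] ≤ T′

≤ᴿ⇒≤ (atom α) = atom α
≤ᴿ⇒≤ (s ⇒ t)  = ≤ˢ⇒≤ s ⇒ ≤ᵀ⇒≤ t

≤ˢ⇒≤ {S} {S′} s = subst (λ S′ → [ S ] ≤ [ S′ ]) (concat-singletons S′)
  (∩-r ([_] ∘ List.lookup S′) (≤ˢ-lookup s))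

≤ᵀ⇒≤ {T} {T′} t = subst (_≤ T′) (concat-singletons T)
  (∪-l ([_] ∘ List.lookup T) (≤ᵀ-lookup t))

Any-≤ᴿ⇒≤ (here r)  = ∩-l _ (≤ᴿ⇒≤ r)
Any-≤ᴿ⇒≤ (there r) = ∩-l-∷ _ (Any-≤ᴿ⇒≤ r)

Any-≤ˢ⇒≤ (here s)  = ∪-r-∷ _ (≤ˢ⇒≤ s)
Any-≤ˢ⇒≤ (there s) = ∪-r [ _ ] (Any-≤ˢ⇒≤ s)

≤ˢ-lookup (r ∷ s) zero    = Any-≤ᴿ⇒≤ r
≤ˢ-lookup (r ∷ s) (suc a) = ≤ˢ-lookup s a

≤ᵀ-lookup (s ∷ t) zero    = Any-≤ˢ⇒≤ s
≤ᵀ-lookup (s ∷ t) (suc a) = ≤ᵀ-lookup t a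

infixr 7 _⇛_

-- Plays the role of an arrow whose source is a union: a function on a union is a function on each
-- of its members.
_⇛_ : Ty → Ty → Sub
Ss ⇛ T = map (_⇒ T) Ss

⇛-mono : U′ ≤ᵀ U → T ≤ᵀ T′ → U ⇛ T ≤ˢ U′ ⇛ T′
⇛-mono u t = All.map⁺ (All.map (Any.map⁺ ∘ Any.map (_⇒ t)) u)

map-⇛-mono : ∀ Us → T ≤ᵀ T′ → map (_⇛ T) Us ≤ᵀ map (_⇛ T′) Us
map-⇛-mono []        t = []
map-⇛-mono (Ss ∷ Us) t = ∷-mono-≤ᵀ (⇛-mono ≤ᵀ-refl t) (map-⇛-mono Us t)

-- Typing by recursion on the term

-- There is no constructor for `atom`: an abstraction is typable only through a union member made up
-- of arrows alone.
data Arrow (P : Sub → Ty → Set) : Raw → Set where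
  arrow : P S T → Arrow P (S ⇒ T)

infix 3 _⊩_∶_∣_ _⊩_∶⊥∣_

-- Subsumption is built into the leaves, so that this is the generation lemma
-- for the declarative system, used as a definition.
_⊩_∶_∣_ : Vec Sub n → Term n m → Ty → Vec Ty m → Set
_⊩_∶⊥∣_ : Vec Sub n → Jump n m → Vec Ty m → Set

Γ ⊩ var x ∶ T ∣ Δ    = Any (lookup Γ x ≤ˢ_) T
Γ ⊩ ƛ M ∶ T ∣ Δ      = Any (All (Arrow λ S T → S ∷ Γ ⊩ M ∶ T ∣ Δ)) T
Γ ⊩ M · N ∶ T ∣ Δ    = ∃[ Us ] (Γ ⊩ M ∶ map (_⇛ T) Us ∣ Δ) × All (λ U → Γ ⊩ N ∶ U ∣ Δ) Us
Γ ⊩ L ⟨≔ M ⟩ ∶ T ∣ Δ = ∃[ U ] (Γ ⊩ M ∶ U ∣ Δ) × All (λ S → S ∷ Γ ⊩ L ∶ T ∣ Δ) U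
Γ ⊩ μ J ∶ T ∣ Δ      = Γ ⊩ J ∶⊥∣ T ∷ Δ

Γ ⊩ ⟦ k ⟧ M ∶⊥∣ Δ    = Γ ⊩ M ∶ lookup Δ k ∣ Δ
Γ ⊩ J ⟨≔ M ⟩ᴶ ∶⊥∣ Δ  = ∃[ U ] (Γ ⊩ M ∶ U ∣ Δ) × All (λ S → S ∷ Γ ⊩ J ∶⊥∣ Δ) U

Arrow-map : {P P′ : Sub → Ty → Set} → (∀ {S T} → P S T → P′ S T) → Arrow P R → Arrow P′ R
Arrow-map f (arrow p) = arrow (f p)

Arrows-map : {P P′ : Sub → Ty → Set} → (∀ {S T} → P S T → P′ S T) →
             Any (All (Arrow P)) T → Any (All (Arrow P′)) T
Arrows-map f = Any.map (All.map (Arrow-map f))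

Arrow-mono : {P P′ : Sub → Ty → Set} →
             (∀ {S S′ T T′} → S′ ≤ˢ S → T ≤ᵀ T′ → P S T → P′ S′ T′) →
             R ≤ᴿ R′ → Arrow P R → Arrow P′ R′
Arrow-mono f (s ⇒ t) (arrow p) = arrow (f s t p)

-- The union member of `T` that is used lies below some member of `T′`, and each raw type in the
-- latter lies above an arrow already justified.
Arrows-mono : {P P′ : Sub → Ty → Set} →
              (∀ {S S′ T T′} → S′ ≤ˢ S → T ≤ᵀ T′ → P S T → P′ S′ T′) →
              T ≤ᵀ T′ → Any (All (Arrow P)) T → Any (All (Arrow P′)) T′
Arrows-mono f t p =
  let _ , S∈T , ps = find p
  in Any.map (All.map λ r → let _ , R∈S , r≤ = find r in Arrow-mono f r≤ (All.lookup ps R∈S))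
             (All.lookup t S∈T)

infix 4 _≤ᶜ_ _≤ᵏ_

_≤ᶜ_ : Rel (Vec Sub n) 0ℓ
_≤ᶜ_ = Pointwiseⱽ.Pointwise _≤ˢ_

_≤ᵏ_ : Rel (Vec Ty m) 0ℓ
_≤ᵏ_ = Pointwiseⱽ.Pointwise _≤ᵀ_

≤ᶜ-refl : Γ ≤ᶜ Γ
≤ᶜ-refl = Pointwiseⱽ.refl ≤ˢ-refl

≤ᵏ-refl : Δ ≤ᵏ Δ
≤ᵏ-refl = Pointwiseⱽ.refl ≤ᵀ-refl

-- Continuations are outputs: a larger type in `Δ` asks less of the term that is passed, so `Δ` is
-- covariant while `Γ` is contravariant.
⊩-mono  : ∀ (M : Term n m) → Γ′ ≤ᶜ Γ → Δ ≤ᵏ Δ′ → T ≤ᵀ T′ → Γ ⊩ M ∶ T ∣ Δ → Γ′ ⊩ M ∶ T′ ∣ Δ′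
⊩-monoᴶ : ∀ (J : Jump n m) → Γ′ ≤ᶜ Γ → Δ ≤ᵏ Δ′ → Γ ⊩ J ∶⊥∣ Δ → Γ′ ⊩ J ∶⊥∣ Δ′

⊩-mono (var x)    γ δ t p = ≤ˢ-Anyᵀ (Pointwiseⱽ.lookup γ x) (Any-≤ᵀ p t)
⊩-mono (ƛ M)      γ δ t p = Arrows-mono (λ s t → ⊩-mono M (s ∷ γ) δ t) t p
⊩-mono (M · N)    γ δ t (Us , p , qs) =
  Us , ⊩-mono M γ δ (map-⇛-mono Us t) p , All.map (⊩-mono N γ δ ≤ᵀ-refl) qs
⊩-mono (L ⟨≔ M ⟩) γ δ t (U , p , qs) =
  U , ⊩-mono M γ δ ≤ᵀ-refl p , All.map (⊩-mono L (≤ˢ-refl ∷ γ) δ t) qs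
⊩-mono (μ J)      γ δ t p = ⊩-monoᴶ J γ (t ∷ δ) p

⊩-monoᴶ (⟦ k ⟧ M)   γ δ p = ⊩-mono M γ δ (Pointwiseⱽ.lookup δ k) p
⊩-monoᴶ (J ⟨≔ M ⟩ᴶ) γ δ (U , p , qs) =
  U , ⊩-mono M γ δ ≤ᵀ-refl p , All.map (⊩-monoᴶ J (≤ˢ-refl ∷ γ) δ) qs

⊩-sub-≤ : ∀ (M : Term n m) → T ≤ᵀ T′ → Γ ⊩ M ∶ T ∣ Δ → Γ ⊩ M ∶ T′ ∣ Δ
⊩-sub-≤ M = ⊩-mono M ≤ᶜ-refl ≤ᵏ-refl

-- Equivalence with the declarative system

⊢⇒⊩  : ∀ {M : Term n m} → Γ ⊢ M ∶ T ∣ Δ → Γ ⊩ M ∶ T ∣ Δ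
⊢⇒⊩ᴶ : ∀ {J : Jump n m} → Γ ⊢ J ∶⊥∣ Δ → Γ ⊩ J ∶⊥∣ Δ

⊢⇒⊩ (var x)   = here ≤ˢ-refl
⊢⇒⊩ (ƛ S T p) = here (All.tabulate⁺ λ a → arrow (⊢⇒⊩ (p a)))
⊢⇒⊩ {Δ = Δ} (app {M = M} {T = T} j S p q) =
  tabulate (λ a → tabulate (S a)) ,
  subst (λ U → _ ⊩ M ∶ U ∣ Δ)
    (≡.sym (≡.trans (map-tabulate _ (_⇛ T)) (tabulate-cong λ a → map-tabulate (S a) (_⇒ T))))
    (⊢⇒⊩ p) ,
  All.tabulate⁺ (λ a → ⊢⇒⊩ (q a))
⊢⇒⊩ (let′ S p q)          = tabulate S , ⊢⇒⊩ q , All.tabulate⁺ (λ a → ⊢⇒⊩ (p a))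
⊢⇒⊩ (μ p)                 = ⊢⇒⊩ᴶ p
⊢⇒⊩ (≤-sub {M = M} p t)   = ⊩-sub-≤ M (≤⇒≤ᵀ t) (⊢⇒⊩ p)

⊢⇒⊩ᴶ (jump k p)   = ⊢⇒⊩ p
⊢⇒⊩ᴶ (let′ S p q) = tabulate S , ⊢⇒⊩ q , All.tabulate⁺ (λ a → ⊢⇒⊩ᴶ (p a))

All-lookup : {A : Set} {P : A → Set} {xs : List A} → All P xs → ∀ a → P (List.lookup xs a)
All-lookup {xs = xs} ps a = All.lookup ps (∈-lookup {xs = xs} a)

-- Brings the arrows of an intersection into the indexed form that the declarative rule `ƛ` expects.
Arrow-family : {P : Sub → Ty → Set} → All (Arrow P) S →
  ∃[ i ] Σ[ Sᵢ ∈ (Fin i → Sub) ] Σ[ Tᵢ ∈ (Fin i → Ty) ]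
    (∀ a → P (Sᵢ a) (Tᵢ a)) × tabulate (λ a → Sᵢ a ⇒ Tᵢ a) ≡ S
Arrow-family [] = 0 , (λ ()) , (λ ()) , (λ ()) , refl
Arrow-family {S = (S₀ ⇒ T₀) ∷ S} (arrow p ∷ ps) =
  let i , Sᵢ , Tᵢ , qs , eq = Arrow-family ps
  in suc i , (λ { zero → S₀ ; (suc a) → Sᵢ a }) , (λ { zero → T₀ ; (suc a) → Tᵢ a }) ,
     (λ { zero → p ; (suc a) → qs a }) , cong ((S₀ ⇒ T₀) ∷_) eq

tabulate-⇛ : ∀ (Us : List Ty) T →
  map (_⇛ T) Us ≡
  tabulate (λ a → tabulate (λ b → List.lookup (List.lookup Us a) b ⇒ T))
tabulate-⇛ []        T = refl
tabulate-⇛ (Ss ∷ Us) T = cong₂ _∷_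
  (≡.trans (cong (_⇛ T) (≡.sym (tabulate-lookup Ss))) (map-tabulate (List.lookup Ss) (_⇒ T)))
  (tabulate-⇛ Us T)

⊩⇒⊢  : ∀ (M : Term n m) → Γ ⊩ M ∶ T ∣ Δ → Γ ⊢ M ∶ T ∣ Δ
⊩⇒⊢ᴶ : ∀ (J : Jump n m) → Γ ⊩ J ∶⊥∣ Δ → Γ ⊢ J ∶⊥∣ Δ

⊩⇒⊢ (var x) p = ≤-sub (var x) (≤ᵀ⇒≤ (p ∷ []))
⊩⇒⊢ {Γ = Γ} {Δ = Δ} (ƛ M) p =
  let _ , S∈T , ps           = find p
      _ , Sᵢ , Tᵢ , qs , eq = Arrow-family ps
  in ≤-sub (subst (λ S → Γ ⊢ ƛ M ∶ [ S ] ∣ Δ) eq (ƛ Sᵢ Tᵢ λ a → ⊩⇒⊢ M (qs a)))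
           -- The rule `ƛ` yields the single member `S`; subsumption restores the rest of the union.
           (≤ᵀ⇒≤ (lose S∈T ≤ˢ-refl ∷ []))
⊩⇒⊢ {Γ = Γ} {T = T} {Δ = Δ} (M · N) (Us , p , qs) =
  app (λ a → length (List.lookup Us a)) (λ a → List.lookup (List.lookup Us a))
    (subst (λ U → Γ ⊢ M ∶ U ∣ Δ) (tabulate-⇛ Us T) (⊩⇒⊢ M p))
    (λ a → subst (λ U → Γ ⊢ N ∶ U ∣ Δ) (≡.sym (tabulate-lookup _)) (⊩⇒⊢ N (All-lookup qs a)))
⊩⇒⊢ {Γ = Γ} {Δ = Δ} (L ⟨≔ M ⟩) (U , p , qs) =
  let′ (List.lookup U) (λ a → ⊩⇒⊢ L (All-lookup qs a))
    (subst (λ U → Γ ⊢ M ∶ U ∣ Δ) (≡.sym (tabulate-lookup U)) (⊩⇒⊢ M p))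
⊩⇒⊢ (μ J) p = μ (⊩⇒⊢ᴶ J p)

⊩⇒⊢ᴶ (⟦ k ⟧ M) p = jump k (⊩⇒⊢ M p)
⊩⇒⊢ᴶ {Γ = Γ} {Δ = Δ} (J ⟨≔ M ⟩ᴶ) (U , p , qs) =
  let′ (List.lookup U) (λ a → ⊩⇒⊢ᴶ J (All-lookup qs a))
    (subst (λ U → Γ ⊢ M ∶ U ∣ Δ) (≡.sym (tabulate-lookup U)) (⊩⇒⊢ M p))

-- Renaming, substitution and their inverses

lookup-lift : {A : Set} {x : A} {xs : Vec A n} {ys : Vec A n′} {ρ : Fin n → Fin n′} →
              (∀ i → lookup ys (ρ i) ≡ lookup xs i) →
              ∀ i → lookup (x ∷ ys) (lift ρ i) ≡ lookup (x ∷ xs) i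
lookup-lift eq zero    = refl
lookup-lift eq (suc i) = eq i

⊩-ren  : ∀ (M : Term n m) {ρ : Fin n → Fin n′} {θ : Fin m → Fin m′} →
         (∀ x → lookup Γ′ (ρ x) ≡ lookup Γ x) → (∀ k → lookup Δ′ (θ k) ≡ lookup Δ k) →
         Γ ⊩ M ∶ T ∣ Δ → Γ′ ⊩ ren ρ θ M ∶ T ∣ Δ′
⊩-renᴶ : ∀ (J : Jump n m) {ρ : Fin n → Fin n′} {θ : Fin m → Fin m′} →
         (∀ x → lookup Γ′ (ρ x) ≡ lookup Γ x) → (∀ k → lookup Δ′ (θ k) ≡ lookup Δ k) →
         Γ ⊩ J ∶⊥∣ Δ → Γ′ ⊩ renᴶ ρ θ J ∶⊥∣ Δ′

⊩-ren {T = T} (var x) γ δ p = subst (λ S → Any (S ≤ˢ_) T) (≡.sym (γ x)) p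
⊩-ren (ƛ M)      γ δ p             = Arrows-map (⊩-ren M (lookup-lift γ) δ) p
⊩-ren (M · N)    γ δ (Us , p , qs) = Us , ⊩-ren M γ δ p , All.map (⊩-ren N γ δ) qs
⊩-ren (L ⟨≔ M ⟩) γ δ (U , p , qs)  = U , ⊩-ren M γ δ p , All.map (⊩-ren L (lookup-lift γ) δ) qs
⊩-ren (μ J)      γ δ p             = ⊩-renᴶ J γ (lookup-lift δ) p

⊩-renᴶ {Γ′ = Γ′} {Δ′ = Δ′} (⟦ k ⟧ M) {ρ} {θ} γ δ p =
  subst (λ T → Γ′ ⊩ ren ρ θ M ∶ T ∣ Δ′) (≡.sym (δ k)) (⊩-ren M γ δ p)
⊩-renᴶ (J ⟨≔ M ⟩ᴶ) γ δ (U , p , qs) = U , ⊩-ren M γ δ p , All.map (⊩-renᴶ J (lookup-lift γ) δ) qs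

-- Typing sees a variable only through its looked-up type, so the same witnesses serve before and
-- after renaming. This is how the conditions "not free in" are used.
⊩-ren⁻  : ∀ (M : Term n m) {ρ : Fin n → Fin n′} {θ : Fin m → Fin m′} →
          (∀ x → lookup Γ′ (ρ x) ≡ lookup Γ x) → (∀ k → lookup Δ′ (θ k) ≡ lookup Δ k) →
          Γ′ ⊩ ren ρ θ M ∶ T ∣ Δ′ → Γ ⊩ M ∶ T ∣ Δ
⊩-ren⁻ᴶ : ∀ (J : Jump n m) {ρ : Fin n → Fin n′} {θ : Fin m → Fin m′} →
          (∀ x → lookup Γ′ (ρ x) ≡ lookup Γ x) → (∀ k → lookup Δ′ (θ k) ≡ lookup Δ k) →
          Γ′ ⊩ renᴶ ρ θ J ∶⊥∣ Δ′ → Γ ⊩ J ∶⊥∣ Δ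

⊩-ren⁻ {T = T} (var x) γ δ p = subst (λ S → Any (S ≤ˢ_) T) (γ x) p
⊩-ren⁻ (ƛ M)      γ δ p             = Arrows-map (⊩-ren⁻ M (lookup-lift γ) δ) p
⊩-ren⁻ (M · N)    γ δ (Us , p , qs) = Us , ⊩-ren⁻ M γ δ p , All.map (⊩-ren⁻ N γ δ) qs
⊩-ren⁻ (L ⟨≔ M ⟩) γ δ (U , p , qs)  = U , ⊩-ren⁻ M γ δ p , All.map (⊩-ren⁻ L (lookup-lift γ) δ) qs
⊩-ren⁻ (μ J)      γ δ p             = ⊩-ren⁻ᴶ J γ (lookup-lift δ) p

⊩-ren⁻ᴶ {Γ = Γ} {Δ = Δ} (⟦ k ⟧ M) γ δ p =
  subst (λ T → Γ ⊩ M ∶ T ∣ Δ) (δ k) (⊩-ren⁻ M γ δ p)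
⊩-ren⁻ᴶ (J ⟨≔ M ⟩ᴶ) γ δ (U , p , qs) = U , ⊩-ren⁻ M γ δ p , All.map (⊩-ren⁻ᴶ J (lookup-lift γ) δ) qs

⊩-wk : ∀ (M : Term n m) → Γ ⊩ M ∶ T ∣ Δ → S ∷ Γ ⊩ wk M ∶ T ∣ Δ
⊩-wk M = ⊩-ren M (λ _ → refl) (λ _ → refl)

⊩-wk⁻ : ∀ (M : Term n m) → S ∷ Γ ⊩ wk M ∶ T ∣ Δ → Γ ⊩ M ∶ T ∣ Δ
⊩-wk⁻ M = ⊩-ren⁻ M (λ _ → refl) (λ _ → refl)

⊩-wkᶜ : ∀ (M : Term n m) → Γ ⊩ M ∶ T ∣ Δ → Γ ⊩ wkᶜ M ∶ T ∣ U ∷ Δ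
⊩-wkᶜ M = ⊩-ren M (λ _ → refl) (λ _ → refl)

⊩-wkᶜ⁻ : ∀ (M : Term n m) → Γ ⊩ wkᶜ M ∶ T ∣ U ∷ Δ → Γ ⊩ M ∶ T ∣ Δ
⊩-wkᶜ⁻ M = ⊩-ren⁻ M (λ _ → refl) (λ _ → refl)

⊩-wk₁ : ∀ (M : Term (suc n) m) → S ∷ Γ ⊩ M ∶ T ∣ Δ → S ∷ S′ ∷ Γ ⊩ wk₁ M ∶ T ∣ Δ
⊩-wk₁ M = ⊩-ren M (lookup-lift λ _ → refl) (λ _ → refl)

⊩-wk₁⁻ : ∀ (M : Term (suc n) m) → S ∷ S′ ∷ Γ ⊩ wk₁ M ∶ T ∣ Δ → S ∷ Γ ⊩ M ∶ T ∣ Δ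
⊩-wk₁⁻ M = ⊩-ren⁻ M (lookup-lift λ _ → refl) (λ _ → refl)

⊩-wk₁ᴶ : ∀ (J : Jump (suc n) m) → S ∷ Γ ⊩ J ∶⊥∣ Δ → S ∷ S′ ∷ Γ ⊩ wk₁ᴶ J ∶⊥∣ Δ
⊩-wk₁ᴶ J = ⊩-renᴶ J (lookup-lift λ _ → refl) (λ _ → refl)

⊩-wk₁ᴶ⁻ : ∀ (J : Jump (suc n) m) → S ∷ S′ ∷ Γ ⊩ wk₁ᴶ J ∶⊥∣ Δ → S ∷ Γ ⊩ J ∶⊥∣ Δ
⊩-wk₁ᴶ⁻ J = ⊩-ren⁻ᴶ J (lookup-lift λ _ → refl) (λ _ → refl)

value-ren : ∀ {V : Term n m} {ρ : Fin n → Fin n′} {θ : Fin m → Fin m′} →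
            Value V → Value (ren ρ θ V)
value-ren (var x) = var _
value-ren (ƛ M)   = ƛ _

-- The clauses for `var` and `ƛ` both choose one member of the union. The restriction of the rules
-- to values is exploited here and in `value-∩`.
value-∪⁻ : ∀ {V : Term n m} → Value V → Γ ⊩ V ∶ T ∣ Δ → Any (λ S → Γ ⊩ V ∶ [ S ] ∣ Δ) T
value-∪⁻ (var x) p = Any.map here p
value-∪⁻ (ƛ M)   p = Any.map here p

value-ω : ∀ {V : Term n m} → Value V → Γ ⊩ V ∶ [ [] ] ∣ Δ
value-ω (var x) = here []
value-ω (ƛ M)   = here []

value-∩ : ∀ {V : Term n m} → Value V → Γ ⊩ V ∶ [ S ] ∣ Δ → Γ ⊩ V ∶ [ S′ ] ∣ Δ →
          Γ ⊩ V ∶ [ S ++ S′ ] ∣ Δ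
value-∩ (var x) (here s) (here s′) = here (All.++⁺ s s′)
value-∩ (ƛ M)   (here s) (here s′) = here (All.++⁺ s s′)

value-⋂ : ∀ {V : Term n m} → Value V → All (λ R → Γ ⊩ V ∶ [ [ R ] ] ∣ Δ) S → Γ ⊩ V ∶ [ S ] ∣ Δ
value-⋂ v []       = value-ω v
value-⋂ v (p ∷ ps) = value-∩ v p (value-⋂ v ps)

⊩-sub  : ∀ (M : Term n m) {σ : Fin n → Term n′ m} → (∀ x → Γ′ ⊩ σ x ∶ [ lookup Γ x ] ∣ Δ) →
         Γ ⊩ M ∶ T ∣ Δ → Γ′ ⊩ sub σ M ∶ T ∣ Δ
⊩-subᴶ : ∀ (J : Jump n m) {σ : Fin n → Term n′ m} → (∀ x → Γ′ ⊩ σ x ∶ [ lookup Γ x ] ∣ Δ) →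
         Γ ⊩ J ∶⊥∣ Δ → Γ′ ⊩ subᴶ σ J ∶⊥∣ Δ

⊩-liftₛ : {σ : Fin n → Term n′ m} → (∀ x → Γ′ ⊩ σ x ∶ [ lookup Γ x ] ∣ Δ) →
          ∀ x → S ∷ Γ′ ⊩ liftₛ σ x ∶ [ lookup (S ∷ Γ) x ] ∣ Δ
⊩-liftₛ         s zero    = here ≤ˢ-refl
⊩-liftₛ {σ = σ} s (suc x) = ⊩-wk (σ x) (s x)

⊩-sub (var x) {σ} s p             = ⊩-sub-≤ (σ x) (p ∷ []) (s x)
⊩-sub (ƛ M)       s p             = Arrows-map (⊩-sub M (⊩-liftₛ s)) p
⊩-sub (M · N)     s (Us , p , qs) = Us , ⊩-sub M s p , All.map (⊩-sub N s) qs
⊩-sub (L ⟨≔ M ⟩)  s (U , p , qs)  = U , ⊩-sub M s p , All.map (⊩-sub L (⊩-liftₛ s)) qs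
⊩-sub (μ J) {σ}   s p             = ⊩-subᴶ J (λ x → ⊩-wkᶜ (σ x) (s x)) p

⊩-subᴶ (⟦ k ⟧ M)   s p            = ⊩-sub M s p
⊩-subᴶ (J ⟨≔ M ⟩ᴶ) s (U , p , qs) = U , ⊩-sub M s p , All.map (⊩-subᴶ J (⊩-liftₛ s)) qs

-- Inverting a substitution produces one assignment for each typing of each
-- subterm; a common one exists because the admissible assignments are directed.
record Directed {C : Set} (_⊑_ : Rel C 0ℓ) (Q : C → Set) : Set where
  field
    {bottom} : C
    Q-bottom : Q bottom
    _⊔_      : C → C → C
    Q-⊔      : ∀ {c d} → Q c → Q d → Q (c ⊔ d)
    ⊑-⊔ˡ     : ∀ c d → c ⊑ (c ⊔ d)
    ⊑-⊔ʳ     : ∀ c d → d ⊑ (c ⊔ d)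

  Monotone : (C → Set) → Set
  Monotone P = ∀ {c d} → c ⊑ d → P c → P d

  both : {P P′ : C → Set} → Monotone P → Monotone P′ →
         ∃[ c ] Q c × P c → ∃[ c ] Q c × P′ c → ∃[ c ] Q c × P c × P′ c
  both mono mono′ (c , q , p) (d , q′ , p′) =
    c ⊔ d , Q-⊔ q q′ , mono (⊑-⊔ˡ c d) p , mono′ (⊑-⊔ʳ c d) p′

  -- The assignments found for the elements of a finite list are joined one after another;
  -- monotonicity carries each proof to the join.
  all : {A : Set} {P : A → C → Set} {xs : List A} → (∀ {x} → Monotone (P x)) →
        All (λ x → ∃[ c ] Q c × P x c) xs → ∃[ c ] Q c × All (λ x → P x c) xs
  all mono []       = bottom , Q-bottom , []
  all mono (p ∷ ps) =
    let c , q , p′ , ps′ = both mono (λ c⊑d → All.map (mono c⊑d)) p (all mono ps)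
    in c , q , p′ ∷ ps′

  -- Only the arrows of the chosen union member have to share an assignment, and they are finitely
  -- many.
  arrows : {P : Sub → Ty → C → Set} → (∀ {S T} → Monotone (P S T)) →
           Any (All (Arrow λ S T → ∃[ c ] Q c × P S T c)) T →
           ∃[ c ] Q c × Any (All (Arrow λ S T → P S T c)) T
  arrows mono p =
    let _ , S∈T , ps = find p
        c , q , ps′  = all (λ c⊑d → Arrow-map (mono c⊑d))
                           (All.map (λ { (arrow (c , q , p)) → c , q , arrow p }) ps)
    in c , q , lose S∈T ps′

⊓-lowerˡ : ∀ (Γ Γ′ : Vec Sub n) → zipWith _++_ Γ Γ′ ≤ᶜ Γ
⊓-lowerˡ []      []        = []
⊓-lowerˡ (S ∷ Γ) (S′ ∷ Γ′) = ⊇⇒≤ˢ (xs⊆xs++ys S S′) ∷ ⊓-lowerˡ Γ Γ′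

⊓-lowerʳ : ∀ (Γ Γ′ : Vec Sub n) → zipWith _++_ Γ Γ′ ≤ᶜ Γ′
⊓-lowerʳ []      []        = []
⊓-lowerʳ (S ∷ Γ) (S′ ∷ Γ′) = ⊇⇒≤ˢ (xs⊆ys++xs S′ S) ∷ ⊓-lowerʳ Γ Γ′

module _ {σ : Fin n → Term n′ m} (v : ∀ x → Value (σ x)) where

  -- The order is reversed: a smaller context carries more information. Joins are pointwise
  -- intersections and the bottom assigns ω everywhere; values admit both.
  value-directed : Directed (λ Γ Γ₁ → Γ₁ ≤ᶜ Γ) (λ Γ → ∀ x → Γ′ ⊩ σ x ∶ [ lookup Γ x ] ∣ Δ)
  value-directed {Γ′ = Γ′} {Δ = Δ} = record
    { bottom   = replicate n []
    ; Q-bottom = λ x → subst (λ S → Γ′ ⊩ σ x ∶ [ S ] ∣ Δ) (≡.sym (lookup-replicate x [])) (value-ω (v x))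
    ; _⊔_      = zipWith _++_
    ; Q-⊔      = λ {Γ} {Γ₁} s s₁ x → subst (λ S → Γ′ ⊩ σ x ∶ [ S ] ∣ Δ)
                   (≡.sym (lookup-zipWith _++_ x Γ Γ₁)) (value-∩ (v x) (s x) (s₁ x))
    ; ⊑-⊔ˡ     = ⊓-lowerˡ
    ; ⊑-⊔ʳ     = ⊓-lowerʳ
    }

  -- The assignment for a lone occurrence of `x`; every other variable gets ω, which any value has.
  value-single : ∀ x → Γ′ ⊩ σ x ∶ [ S ] ∣ Δ →
                 ∀ y → Γ′ ⊩ σ y ∶ [ lookup (replicate n [] [ x ]≔ S) y ] ∣ Δ
  value-single {Γ′ = Γ′} {S = S} {Δ = Δ} x p y with y ≟ x
  ... | yes refl = subst (λ S → Γ′ ⊩ σ y ∶ [ S ] ∣ Δ) (≡.sym (lookup∘update x (replicate n []) S)) p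
  ... | no y≢x   = subst (λ S → Γ′ ⊩ σ y ∶ [ S ] ∣ Δ)
    (≡.sym (≡.trans (lookup∘update′ y≢x (replicate n []) S) (lookup-replicate y []))) (value-ω (v y))

  value-liftₛ : ∀ x → Value (liftₛ σ x)
  value-liftₛ zero    = var zero
  value-liftₛ (suc x) = value-ren (v x)

-- The bound variable is replaced by itself, so the type `S₁` found for it is above its actual type
-- `S`, and narrowing puts `S` back.
⊩-liftₛ⁻ : {P : Vec Sub (suc n) → Set} {σ : Fin n → Term n′ m} →
           (∀ {Γ Γ₁} → Γ₁ ≤ᶜ Γ → P Γ → P Γ₁) →
           ∃[ Γ ] (∀ x → S ∷ Γ′ ⊩ liftₛ σ x ∶ [ lookup Γ x ] ∣ Δ) × P Γ →
           ∃[ Γ ] (∀ x → Γ′ ⊩ σ x ∶ [ lookup Γ x ] ∣ Δ) × P (S ∷ Γ)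
⊩-liftₛ⁻ {σ = σ} mono (S₁ ∷ Γ , s , p) with s zero
... | here S≤S₁ = Γ , (λ x → ⊩-wk⁻ (σ x) (s (suc x))) , mono (S≤S₁ ∷ ≤ᶜ-refl) p

⊩-narrow : ∀ (M : Term n m) → Γ′ ≤ᶜ Γ → Γ ⊩ M ∶ T ∣ Δ → Γ′ ⊩ M ∶ T ∣ Δ
⊩-narrow M γ = ⊩-mono M γ ≤ᵏ-refl ≤ᵀ-refl

⊩-narrowᴶ : ∀ (J : Jump n m) → Γ′ ≤ᶜ Γ → Γ ⊩ J ∶⊥∣ Δ → Γ′ ⊩ J ∶⊥∣ Δ
⊩-narrowᴶ J γ = ⊩-monoᴶ J γ ≤ᵏ-refl

-- Each occurrence of a variable records the type at which its value is used; the records of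
-- different subderivations are merged by `both`, `all` and `arrows`.
⊩-sub⁻  : ∀ (M : Term n m) {σ : Fin n → Term n′ m} → (∀ x → Value (σ x)) →
          Γ′ ⊩ sub σ M ∶ T ∣ Δ →
          ∃[ Γ ] (∀ x → Γ′ ⊩ σ x ∶ [ lookup Γ x ] ∣ Δ) × (Γ ⊩ M ∶ T ∣ Δ)
⊩-sub⁻ᴶ : ∀ (J : Jump n m) {σ : Fin n → Term n′ m} → (∀ x → Value (σ x)) →
          Γ′ ⊩ subᴶ σ J ∶⊥∣ Δ →
          ∃[ Γ ] (∀ x → Γ′ ⊩ σ x ∶ [ lookup Γ x ] ∣ Δ) × (Γ ⊩ J ∶⊥∣ Δ)

⊩-sub⁻ {n = n} (var x) v p =
  let S , S∈T , q = find (value-∪⁻ (v x) p)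
  in replicate n [] [ x ]≔ S , value-single v x q ,
     lose S∈T (subst (_≤ˢ S) (≡.sym (lookup∘update x (replicate n []) S)) ≤ˢ-refl)
⊩-sub⁻ (ƛ M) v p =
  arrows (λ γ → ⊩-narrow M (≤ˢ-refl ∷ γ))
    (Arrows-map (λ q → ⊩-liftₛ⁻ (⊩-narrow M) (⊩-sub⁻ M (value-liftₛ v) q)) p)
  where open Directed (value-directed v)
⊩-sub⁻ (M · N) v (Us , p , qs) =
  let Γ , s , p′ , qs′ = both (⊩-narrow M) (λ γ → All.map (⊩-narrow N γ))
                              (⊩-sub⁻ M v p) (all (⊩-narrow N) (All.map (⊩-sub⁻ N v) qs))
  in Γ , s , Us , p′ , qs′
  where open Directed (value-directed v)
⊩-sub⁻ (L ⟨≔ M ⟩) v (U , p , qs) =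
  let Γ , s , p′ , qs′ = both (⊩-narrow M) (λ γ → All.map (⊩-narrow L (≤ˢ-refl ∷ γ)))
        (⊩-sub⁻ M v p)
        (all (λ γ → ⊩-narrow L (≤ˢ-refl ∷ γ))
          (All.map (λ q → ⊩-liftₛ⁻ (⊩-narrow L) (⊩-sub⁻ L (value-liftₛ v) q)) qs))
  in Γ , s , U , p′ , qs′
  where open Directed (value-directed v)
⊩-sub⁻ (μ J) {σ} v p =
  let Γ , s , p′ = ⊩-sub⁻ᴶ J (value-ren ∘ v) p
  in Γ , (λ x → ⊩-wkᶜ⁻ (σ x) (s x)) , p′

⊩-sub⁻ᴶ (⟦ k ⟧ M) v p = ⊩-sub⁻ M v p
⊩-sub⁻ᴶ (J ⟨≔ M ⟩ᴶ) v (U , p , qs) =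
  let Γ , s , p′ , qs′ = both (⊩-narrow M) (λ γ → All.map (⊩-narrowᴶ J (≤ˢ-refl ∷ γ)))
        (⊩-sub⁻ M v p)
        (all (λ γ → ⊩-narrowᴶ J (≤ˢ-refl ∷ γ))
          (All.map (λ q → ⊩-liftₛ⁻ (⊩-narrowᴶ J) (⊩-sub⁻ᴶ J (value-liftₛ v) q)) qs))
  in Γ , s , U , p′ , qs′
  where open Directed (value-directed v)

-- Dual to `value-directed`: information grows by union, starting from ℧.
All-directed : {P : Sub → Set} → Directed _≤ᵀ_ (All P)
All-directed = record
  { Q-bottom = []
  ; _⊔_      = _++_
  ; Q-⊔      = All.++⁺
  ; ⊑-⊔ˡ     = λ U U′ → ⊆⇒≤ᵀ (xs⊆xs++ys U U′)
  ; ⊑-⊔ʳ     = λ U U′ → ⊆⇒≤ᵀ (xs⊆ys++xs U′ U)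
  }

-- Context substitution for a continuation and its inverse

update-mono : ∀ (Δ : Vec Ty m) k → U ≤ᵀ U′ → Δ [ k ]≔ U ≤ᵏ Δ [ k ]≔ U′
update-mono (T ∷ Δ) zero    u = u ∷ ≤ᵏ-refl
update-mono (T ∷ Δ) (suc k) u = ≤ᵀ-refl ∷ update-mono Δ k u

⊩-update : ∀ (P : Term n m) k → U ≤ᵀ U′ → Γ ⊩ P ∶ T ∣ Δ [ k ]≔ U → Γ ⊩ P ∶ T ∣ Δ [ k ]≔ U′
⊩-update {Δ = Δ} P k u = ⊩-mono P ≤ᶜ-refl (update-mono Δ k u) ≤ᵀ-refl

⊩-updateᴶ : ∀ (J : Jump n m) k → U ≤ᵀ U′ → Γ ⊩ J ∶⊥∣ Δ [ k ]≔ U → Γ ⊩ J ∶⊥∣ Δ [ k ]≔ U′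
⊩-updateᴶ {Δ = Δ} J k u = ⊩-monoᴶ J ≤ᶜ-refl (update-mono Δ k u)

-- Before the substitution `k` receives the term to be bound in `M`, hence has type `U`; afterwards
-- it receives the result of `M`, hence has its type in `Δ`.
⊩-csub  : ∀ (P : Term n m) {k M} → All (λ S → S ∷ Γ ⊩ M ∶ lookup Δ k ∣ Δ) U →
          Γ ⊩ P ∶ T ∣ Δ [ k ]≔ U → Γ ⊩ csub k M P ∶ T ∣ Δ
⊩-csubᴶ : ∀ (J : Jump n m) {k M} → All (λ S → S ∷ Γ ⊩ M ∶ lookup Δ k ∣ Δ) U →
          Γ ⊩ J ∶⊥∣ Δ [ k ]≔ U → Γ ⊩ csubᴶ k M J ∶⊥∣ Δ

⊩-csub (var x)        u p             = p
⊩-csub (ƛ P) {M = M}  u p             = Arrows-map (⊩-csub P (All.map (⊩-wk₁ M) u)) p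
⊩-csub (P · Q)        u (Us , p , qs) = Us , ⊩-csub P u p , All.map (⊩-csub Q u) qs
⊩-csub (P ⟨≔ Q ⟩) {M = M} u (V , p , qs) =
  V , ⊩-csub Q u p , All.map (⊩-csub P (All.map (⊩-wk₁ M) u)) qs
⊩-csub (μ J) {M = M}  u p             = ⊩-csubᴶ J (All.map (⊩-wkᶜ M) u) p

⊩-csubᴶ {Γ = Γ} {Δ = Δ} {U = U} (⟦ l ⟧ Q) {k} u p with l ≟ k
... | yes refl = U , ⊩-csub Q u (subst (λ T → Γ ⊩ Q ∶ T ∣ Δ [ k ]≔ U) (lookup∘update k Δ U) p) , u
... | no l≢k   = ⊩-csub Q u (subst (λ T → Γ ⊩ Q ∶ T ∣ Δ [ k ]≔ U) (lookup∘update′ l≢k Δ U) p)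
⊩-csubᴶ (J ⟨≔ Q ⟩ᴶ) {M = M} u (V , p , qs) =
  V , ⊩-csub Q u p , All.map (⊩-csubᴶ J (All.map (⊩-wk₁ M) u)) qs

⊩-csub⁻  : ∀ (P : Term n m) {k M} → Γ ⊩ csub k M P ∶ T ∣ Δ →
           ∃[ U ] All (λ S → S ∷ Γ ⊩ M ∶ lookup Δ k ∣ Δ) U × (Γ ⊩ P ∶ T ∣ Δ [ k ]≔ U)
⊩-csub⁻ᴶ : ∀ (J : Jump n m) {k M} → Γ ⊩ csubᴶ k M J ∶⊥∣ Δ →
           ∃[ U ] All (λ S → S ∷ Γ ⊩ M ∶ lookup Δ k ∣ Δ) U × (Γ ⊩ J ∶⊥∣ Δ [ k ]≔ U)

-- A variable contains no jump to `k`, so the empty union suffices.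
⊩-csub⁻ (var x) p = [] , [] , p
⊩-csub⁻ (ƛ P) {k} {M} p =
  arrows (⊩-update P k)
    (Arrows-map (λ q → let U , u , q′ = ⊩-csub⁻ P q in U , All.map (⊩-wk₁⁻ M) u , q′) p)
  where open Directed All-directed
⊩-csub⁻ (P · Q) {k} (Us , p , qs) =
  let U , u , p′ , qs′ = both (⊩-update P k) (λ u → All.map (⊩-update Q k u))
        (⊩-csub⁻ P p) (all (⊩-update Q k) (All.map (⊩-csub⁻ Q) qs))
  in U , u , Us , p′ , qs′
  where open Directed All-directed
⊩-csub⁻ {Γ = Γ} {T = T} {Δ = Δ} (P ⟨≔ Q ⟩) {k} {M} (V , p , qs) =
  let U , u , p′ , qs′ = both (⊩-update Q k) (λ u → All.map (⊩-update P k u))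
        (⊩-csub⁻ Q p)
        (all {P = λ S U → S ∷ Γ ⊩ P ∶ T ∣ Δ [ k ]≔ U} (⊩-update P k)
          (All.map (λ q → let U , u , q′ = ⊩-csub⁻ P q in U , All.map (⊩-wk₁⁻ M) u , q′) qs))
  in U , u , V , p′ , qs′
  where open Directed All-directed
⊩-csub⁻ (μ J) {M = M} p =
  let U , u , p′ = ⊩-csub⁻ᴶ J p in U , All.map (⊩-wkᶜ⁻ M) u , p′

⊩-csub⁻ᴶ {Γ = Γ} {Δ = Δ} (⟦ l ⟧ Q) {k} p with l ≟ k
⊩-csub⁻ᴶ {Γ = Γ} {Δ = Δ} (⟦ l ⟧ Q) (V , p , v) | yes refl =
  let U , u , p′ = ⊩-csub⁻ Q p
  -- `V` is the type of the term passed by this jump, `U` serves the jumps to the same continuation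
  -- inside `Q`.
  in V ++ U , All.++⁺ v u ,
     subst (λ T → Γ ⊩ Q ∶ T ∣ Δ [ l ]≔ (V ++ U)) (≡.sym (lookup∘update l Δ (V ++ U)))
       (⊩-sub-≤ Q (⊆⇒≤ᵀ (xs⊆xs++ys V U)) (⊩-update Q l (⊆⇒≤ᵀ (xs⊆ys++xs U V)) p′))
⊩-csub⁻ᴶ {Γ = Γ} {Δ = Δ} (⟦ l ⟧ Q) {k} p | no l≢k =
  let U , u , p′ = ⊩-csub⁻ Q p
  in U , u , subst (λ T → Γ ⊩ Q ∶ T ∣ Δ [ k ]≔ U) (≡.sym (lookup∘update′ l≢k Δ U)) p′
⊩-csub⁻ᴶ {Γ = Γ} {Δ = Δ} (J ⟨≔ Q ⟩ᴶ) {k} {M} (V , p , qs) =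
  let U , u , p′ , qs′ = both (⊩-update Q k) (λ u → All.map (⊩-updateᴶ J k u))
        (⊩-csub⁻ Q p)
        (all {P = λ S U → S ∷ Γ ⊩ J ∶⊥∣ Δ [ k ]≔ U} (⊩-updateᴶ J k)
          (All.map (λ q → let U , u , q′ = ⊩-csub⁻ᴶ J q in U , All.map (⊩-wk₁⁻ M) u , q′) qs))
  in U , u , V , p′ , qs′
  where open Directed All-directed

-- Reduction and expansion at the root

-- The `where` takes the union type of `N` apart, so each branch binds the new variable to one
-- `U ⇛ T` and applies it to an argument of type `U`.
⊩-ad₁ : ∀ (N M : Term n m) → Γ ⊩ N · M ∶ T ∣ Δ → Γ ⊩ (var zero · wk M) ⟨≔ N ⟩ ∶ T ∣ Δ
⊩-ad₁ N M (Us , p , qs) =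
  map (_⇛ _) Us , p , All.map⁺ (All.map (λ {U} q → [ U ] , here ≤ˢ-refl , ⊩-wk M q ∷ []) qs)

-- In each branch the operator is a variable, which selects a single argument type `U₀`. The list of
-- these selections is the witness for the application.
⊩-ad₁⁻ : ∀ (N M : Term n m) → Γ ⊩ (var zero · wk M) ⟨≔ N ⟩ ∶ T ∣ Δ → Γ ⊩ N · M ∶ T ∣ Δ
⊩-ad₁⁻ {Γ = Γ} {T = T} {Δ = Δ} N M (U , p , qs) =
  let Us , u , ms = choose qs in Us , ⊩-sub-≤ N u p , ms
  where
  choose : All (λ S → S ∷ Γ ⊩ var zero · wk M ∶ T ∣ Δ) U′ →
           ∃[ Us ] U′ ≤ᵀ map (_⇛ T) Us × All (λ U → Γ ⊩ M ∶ U ∣ Δ) Us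
  choose []                  = [] , [] , []
  choose ((Us , s , ms) ∷ qs) =
    let U₀ , U₀∈Us , s₀ = find (Any.map⁻ s)
        Us′ , u , ms′   = choose qs
    in U₀ ∷ Us′ , here s₀ ∷ All.map there u , ⊩-wk⁻ M (All.lookup ms U₀∈Us) ∷ ms′

⊩-η : ∀ (M : Term n m) → Γ ⊩ M ∶ [ [ S ⇒ T ] ] ∣ Δ → S ∷ Γ ⊩ wk M · var zero ∶ T ∣ Δ
⊩-η {S = S} M p = [ [ S ] ] , ⊩-wk M p , here ≤ˢ-refl ∷ []

module _ {V : Term n m} (v : Value V) where

  -- The value selects one `U ⇛ T`, and the argument variable of type `S` shows that `S` is below a
  -- member of `U`; hence `U ⇛ T` is below the arrow from `S` to `T`.
  value-η⁻ : S ∷ Γ ⊩ wk V · var zero ∶ T ∣ Δ → Γ ⊩ V ∶ [ [ S ⇒ T ] ] ∣ Δ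
  value-η⁻ (Us , p , qs) =
    let U , U∈Us , p′ = find (Any.map⁻ (value-∪⁻ (value-ren v) p))
    in ⊩-sub-≤ V (≤ˢ⇒≤ᵀ (⇛-mono (All.lookup qs U∈Us ∷ []) ≤ᵀ-refl)) (⊩-wk⁻ V p′)

  ⊩-ad₂ : ∀ N → Γ ⊩ V · N ∶ T ∣ Δ → Γ ⊩ (wk V · var zero) ⟨≔ N ⟩ ∶ T ∣ Δ
  ⊩-ad₂ N (Us , p , qs) =
    let U , U∈Us , p′ = find (Any.map⁻ (value-∪⁻ v p))
    in U , All.lookup qs U∈Us , All.tabulate λ S∈U → ⊩-η V
         (⊩-sub-≤ V (≤ˢ⇒≤ᵀ (⇛-mono (lose S∈U ≤ˢ-refl ∷ []) ≤ᵀ-refl)) p′)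

  -- Every branch gives `V` one arrow; since `V` is a value, they intersect to `U ⇛ T`.
  ⊩-ad₂⁻ : ∀ N → Γ ⊩ (wk V · var zero) ⟨≔ N ⟩ ∶ T ∣ Δ → Γ ⊩ V · N ∶ T ∣ Δ
  ⊩-ad₂⁻ N (U , p , qs) = [ U ] , value-⋂ v (All.map⁺ (All.map value-η⁻ qs)) , p ∷ []

  ⊩-βlet : ∀ M → Γ ⊩ M ⟨≔ V ⟩ ∶ T ∣ Δ → Γ ⊩ M [ V /0] ∶ T ∣ Δ
  ⊩-βlet M (U , p , qs) =
    let S , S∈U , p′ = find (value-∪⁻ v p)
    in ⊩-sub M (λ { zero → p′ ; (suc x) → here ≤ˢ-refl }) (All.lookup qs S∈U)

  -- The recovered context types the substituted value by its head. The other variables are replaced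
  -- by themselves, so their recovered types are above those in `Γ`.
  ⊩-βlet⁻ : ∀ M → Γ ⊩ M [ V /0] ∶ T ∣ Δ → Γ ⊩ M ⟨≔ V ⟩ ∶ T ∣ Δ
  ⊩-βlet⁻ M p with ⊩-sub⁻ M (λ { zero → v ; (suc x) → var x }) p
  ... | S ∷ Γ₁ , s , q = [ S ] , s zero , ⊩-narrow M (≤ˢ-refl ∷ lookup⇒≤ᶜ (s ∘ suc)) q ∷ []
    where
    lookup⇒≤ᶜ : (∀ x → Any (lookup Γ x ≤ˢ_) [ lookup Γ′ x ]) → Γ ≤ᶜ Γ′
    lookup⇒≤ᶜ {Γ = []}    {Γ′ = []}    s = []
    lookup⇒≤ᶜ {Γ = _ ∷ _} {Γ′ = _ ∷ _} s = ≤ᵀ⇒≤ˢ (s zero ∷ []) ∷ lookup⇒≤ᶜ (s ∘ suc)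

  ⊩-ηλ : Γ ⊩ ƛ (wk V · var zero) ∶ T ∣ Δ → Γ ⊩ V ∶ T ∣ Δ
  ⊩-ηλ p =
    let S , S∈T , ps = find p
    in ⊩-sub-≤ V (lose S∈T ≤ˢ-refl ∷ []) (value-⋂ v (All.map (λ { (arrow q) → value-η⁻ q }) ps))

⊩-βλ : ∀ (M : Term (suc n) m) V → Γ ⊩ ƛ M · V ∶ T ∣ Δ → Γ ⊩ M ⟨≔ V ⟩ ∶ T ∣ Δ
⊩-βλ M V (Us , p , qs) =
  let U , U∈Us , ps = find (Any.map⁻ p)
  in U , All.lookup qs U∈Us , All.map (λ { (arrow q) → q }) (All.map⁻ ps)

⊩-βλ⁻ : ∀ (M : Term (suc n) m) V → Γ ⊩ M ⟨≔ V ⟩ ∶ T ∣ Δ → Γ ⊩ ƛ M · V ∶ T ∣ Δ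
⊩-βλ⁻ M V (U , p , qs) = [ U ] , here (All.map⁺ (All.map arrow qs)) , p ∷ []

-- Updating index zero of `T ∷ Δ` to `U` gives exactly the continuation context in which `μ J` of
-- type `U` types its body.
⊩-βμ : ∀ (M : Term (suc n) m) J → Γ ⊩ M ⟨≔ μ J ⟩ ∶ T ∣ Δ → Γ ⊩ μ (csubᴶ zero (wkᶜ M) J) ∶ T ∣ Δ
⊩-βμ M J (U , p , qs) = ⊩-csubᴶ J (All.map (⊩-wkᶜ M) qs) p

⊩-βμ⁻ : ∀ (M : Term (suc n) m) J → Γ ⊩ μ (csubᴶ zero (wkᶜ M) J) ∶ T ∣ Δ → Γ ⊩ M ⟨≔ μ J ⟩ ∶ T ∣ Δ
⊩-βμ⁻ M J p = let U , u , p′ = ⊩-csub⁻ᴶ J p in U , p′ , All.map (⊩-wkᶜ⁻ M) u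

⊩-ηlet⁻ : ∀ (M : Term n m) → Γ ⊩ M ∶ T ∣ Δ → Γ ⊩ var zero ⟨≔ M ⟩ ∶ T ∣ Δ
-- That `var zero` has type `T` in all branches unfolds to `T ≤ᵀ T`.
⊩-ηlet⁻ {T = T} M p = T , p , ≤ᵀ-refl

-- The jump forces the bound continuation to have the type of `l`, so identifying the two is a
-- type-preserving renaming.
⊩-βjmp : ∀ (J : Jump n (suc m)) l → Γ ⊩ ⟦ l ⟧ μ J ∶⊥∣ Δ → Γ ⊩ J [ l /0]ᶜ ∶⊥∣ Δ
⊩-βjmp J l = ⊩-renᴶ J (λ _ → refl) (λ { zero → refl ; (suc k) → refl })

⊩-βjmp⁻ : ∀ (J : Jump n (suc m)) l → Γ ⊩ J [ l /0]ᶜ ∶⊥∣ Δ → Γ ⊩ ⟦ l ⟧ μ J ∶⊥∣ Δ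
⊩-βjmp⁻ J l = ⊩-ren⁻ᴶ J (λ _ → refl) (λ { zero → refl ; (suc k) → refl })

-- Invariance under the congruence

-- Both directions are proved together because `sym` exchanges them.
⊩-≈   : ∀ {M N : Term n m} → M ≈ N → Γ ⊩ M ∶ T ∣ Δ → Γ ⊩ N ∶ T ∣ Δ
⊩-≈˘  : ∀ {M N : Term n m} → M ≈ N → Γ ⊩ N ∶ T ∣ Δ → Γ ⊩ M ∶ T ∣ Δ
⊩-≈ᴶ  : ∀ {J K : Jump n m} → J ≈ᴶ K → Γ ⊩ J ∶⊥∣ Δ → Γ ⊩ K ∶⊥∣ Δ
⊩-≈ᴶ˘ : ∀ {J K : Jump n m} → J ≈ᴶ K → Γ ⊩ K ∶⊥∣ Δ → Γ ⊩ J ∶⊥∣ Δ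

⊩-≈ (E1 L M N) (U , (V , p , qs) , rs) = V , p , All.map (λ q → U , q , All.map (⊩-wk₁ L) rs) qs
⊩-≈ (E2 J M)   (U , p , qs)            = U , ⊩-wkᶜ M p , qs
⊩-≈ refl       p                       = p
⊩-≈ (sym e)    p                       = ⊩-≈˘ e p
⊩-≈ (trans e f) p                      = ⊩-≈ f (⊩-≈ e p)
⊩-≈ (ƛ e)      p                       = Arrows-map (⊩-≈ e) p
⊩-≈ (e · f)    (Us , p , qs)           = Us , ⊩-≈ e p , All.map (⊩-≈ f) qs
⊩-≈ (e ⟨≔ f ⟩) (U , p , qs)            = U , ⊩-≈ f p , All.map (⊩-≈ e) qs
⊩-≈ (μ e)      p                       = ⊩-≈ᴶ e p

⊩-≈˘ (E1 L M N) (V , p , qs) =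
  -- Each branch over `N` types `M` by a union of its own; the join of these unions serves all
  -- branches.
  let U , rs , qs′ = all (⊩-sub-≤ M) (All.map (λ (U , q , rs) → U , All.map (⊩-wk₁⁻ L) rs , q) qs)
  in U , (V , p , qs′) , rs
  where open Directed All-directed
⊩-≈˘ (E2 J M)   (U , p , qs)            = U , ⊩-wkᶜ⁻ M p , qs
⊩-≈˘ refl       p                       = p
⊩-≈˘ (sym e)    p                       = ⊩-≈ e p
⊩-≈˘ (trans e f) p                      = ⊩-≈˘ e (⊩-≈˘ f p)
⊩-≈˘ (ƛ e)      p                       = Arrows-map (⊩-≈˘ e) p
⊩-≈˘ (e · f)    (Us , p , qs)           = Us , ⊩-≈˘ e p , All.map (⊩-≈˘ f) qs
⊩-≈˘ (e ⟨≔ f ⟩) (U , p , qs)            = U , ⊩-≈˘ f p , All.map (⊩-≈˘ e) qs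
⊩-≈˘ (μ e)      p                       = ⊩-≈ᴶ˘ e p

⊩-≈ᴶ (E1 J M N) (U , (V , p , qs) , rs) = V , p , All.map (λ q → U , q , All.map (⊩-wk₁ᴶ J) rs) qs
⊩-≈ᴶ (E3 k L M) p                       = p
⊩-≈ᴶ refl       p                       = p
⊩-≈ᴶ (sym e)    p                       = ⊩-≈ᴶ˘ e p
⊩-≈ᴶ (trans e f) p                      = ⊩-≈ᴶ f (⊩-≈ᴶ e p)
⊩-≈ᴶ (⟦ k ⟧ e)  p                       = ⊩-≈ e p
⊩-≈ᴶ (e ⟨≔ f ⟩ᴶ) (U , p , qs)           = U , ⊩-≈ f p , All.map (⊩-≈ᴶ e) qs

⊩-≈ᴶ˘ (E1 J M N) (V , p , qs) =
  let U , rs , qs′ = all (⊩-sub-≤ M) (All.map (λ (U , q , rs) → U , All.map (⊩-wk₁ᴶ⁻ J) rs , q) qs)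
  in U , (V , p , qs′) , rs
  where open Directed All-directed
⊩-≈ᴶ˘ (E3 k L M) p                       = p
⊩-≈ᴶ˘ refl       p                       = p
⊩-≈ᴶ˘ (sym e)    p                       = ⊩-≈ᴶ e p
⊩-≈ᴶ˘ (trans e f) p                      = ⊩-≈ᴶ˘ e (⊩-≈ᴶ˘ f p)
⊩-≈ᴶ˘ (⟦ k ⟧ e)  p                       = ⊩-≈˘ e p
⊩-≈ᴶ˘ (e ⟨≔ f ⟩ᴶ) (U , p , qs)           = U , ⊩-≈˘ f p , All.map (⊩-≈ᴶ˘ e) qs

-- Subject reduction

⊩-⟶  : ∀ {M N : Term n m} → M ⟶ N → Γ ⊩ M ∶ T ∣ Δ → Γ ⊩ N ∶ T ∣ Δ
⊩-⟶ᴶ : ∀ {J K : Jump n m} → J ⟶ᴶ K → Γ ⊩ J ∶⊥∣ Δ → Γ ⊩ K ∶⊥∣ Δ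

⊩-⟶ (ad₁ {N} {M} _)   p             = ⊩-ad₁ N M p
⊩-⟶ (ad₂ {N = N} v _) p             = ⊩-ad₂ v N p
⊩-⟶ (βλ {M} {V} _)    p             = ⊩-βλ M V p
⊩-⟶ (βlet {M} v)      p             = ⊩-βlet v M p
⊩-⟶ (βμ {M} {J})      p             = ⊩-βμ M J p
⊩-⟶ (ηλ v)            p             = ⊩-ηλ v p
⊩-⟶ (ηlet {M})        (U , p , qs)  = ⊩-sub-≤ M qs p
⊩-⟶ (ημ {M})          p             = ⊩-wkᶜ⁻ M p
⊩-⟶ (ξƛ r)            p             = Arrows-map (⊩-⟶ r) p
⊩-⟶ (ξ·ˡ r)           (Us , p , qs) = Us , ⊩-⟶ r p , qs
⊩-⟶ (ξ·ʳ r)           (Us , p , qs) = Us , p , All.map (⊩-⟶ r) qs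
⊩-⟶ (ξ≔ˡ r)           (U , p , qs)  = U , p , All.map (⊩-⟶ r) qs
⊩-⟶ (ξ≔ʳ r)           (U , p , qs)  = U , ⊩-⟶ r p , qs
⊩-⟶ (ξμ r)            p             = ⊩-⟶ᴶ r p

⊩-⟶ᴶ (βjmp {l} {J}) p            = ⊩-βjmp J l p
⊩-⟶ᴶ (ξjmp r)       p            = ⊩-⟶ r p
⊩-⟶ᴶ (ξ≔ˡ r)        (U , p , qs) = U , p , All.map (⊩-⟶ᴶ r) qs
⊩-⟶ᴶ (ξ≔ʳ r)        (U , p , qs) = U , ⊩-⟶ r p , qs

-- Subject expansion

-- An atom cannot be the type of an abstraction, so η-expansion fails at atoms;
-- every occurrence of an atom is therefore replaced by ω → ℧.
⌊_⌋ᴿ : Raw → Raw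
⌊_⌋ˢ : Sub → Sub
⌊_⌋ᵀ : Ty → Ty

⌊ atom α ⌋ᴿ = [] ⇒ []
⌊ S ⇒ T ⌋ᴿ  = ⌊ S ⌋ˢ ⇒ ⌊ T ⌋ᵀ

⌊ [] ⌋ˢ    = []
⌊ R ∷ S ⌋ˢ = ⌊ R ⌋ᴿ ∷ ⌊ S ⌋ˢ

⌊ [] ⌋ᵀ    = []
⌊ S ∷ T ⌋ᵀ = ⌊ S ⌋ˢ ∷ ⌊ T ⌋ᵀ

⌊⌋-≤ᴿ  : R ≤ᴿ R′ → ⌊ R ⌋ᴿ ≤ᴿ ⌊ R′ ⌋ᴿ
⌊⌋-≤ˢ  : S ≤ˢ S′ → ⌊ S ⌋ˢ ≤ˢ ⌊ S′ ⌋ˢ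
⌊⌋-≤ᵀ  : T ≤ᵀ T′ → ⌊ T ⌋ᵀ ≤ᵀ ⌊ T′ ⌋ᵀ
⌊⌋-∋≤ᴿ : Any (_≤ᴿ R) S → Any (_≤ᴿ ⌊ R ⌋ᴿ) ⌊ S ⌋ˢ
⌊⌋-≤∈ᵀ : Any (S ≤ˢ_) T → Any (⌊ S ⌋ˢ ≤ˢ_) ⌊ T ⌋ᵀ

⌊⌋-≤ᴿ (atom α) = ≤ᴿ-refl _
⌊⌋-≤ᴿ (s ⇒ t)  = ⌊⌋-≤ˢ s ⇒ ⌊⌋-≤ᵀ t

⌊⌋-≤ˢ []      = []
⌊⌋-≤ˢ (r ∷ s) = ⌊⌋-∋≤ᴿ r ∷ ⌊⌋-≤ˢ s

⌊⌋-≤ᵀ []      = []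
⌊⌋-≤ᵀ (s ∷ t) = ⌊⌋-≤∈ᵀ s ∷ ⌊⌋-≤ᵀ t

⌊⌋-∋≤ᴿ (here r)  = here (⌊⌋-≤ᴿ r)
⌊⌋-∋≤ᴿ (there r) = there (⌊⌋-∋≤ᴿ r)

⌊⌋-≤∈ᵀ (here s)  = here (⌊⌋-≤ˢ s)
⌊⌋-≤∈ᵀ (there s) = there (⌊⌋-≤∈ᵀ s)

⌊⌋-⇛ : ∀ Ss T → ⌊ Ss ⇛ T ⌋ˢ ≡ ⌊ Ss ⌋ᵀ ⇛ ⌊ T ⌋ᵀ
⌊⌋-⇛ []       T = refl
⌊⌋-⇛ (S ∷ Ss) T = cong (_ ∷_) (⌊⌋-⇛ Ss T)

⌊⌋-map-⇛ : ∀ Us T → ⌊ map (_⇛ T) Us ⌋ᵀ ≡ map (_⇛ ⌊ T ⌋ᵀ) (map ⌊_⌋ᵀ Us)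
⌊⌋-map-⇛ []       T = refl
⌊⌋-map-⇛ (U ∷ Us) T = cong₂ _∷_ (⌊⌋-⇛ U T) (⌊⌋-map-⇛ Us T)

⌊⌋-Any : {P P′ : Sub → Set} → (∀ {S} → P S → P′ ⌊ S ⌋ˢ) → Any P T → Any P′ ⌊ T ⌋ᵀ
⌊⌋-Any f (here p)  = here (f p)
⌊⌋-Any f (there p) = there (⌊⌋-Any f p)

⌊⌋-All : {P P′ : Sub → Set} → (∀ {S} → P S → P′ ⌊ S ⌋ˢ) → All P T → All P′ ⌊ T ⌋ᵀ
⌊⌋-All f []       = []
⌊⌋-All f (p ∷ ps) = f p ∷ ⌊⌋-All f ps

⌊⌋-Arrow : {P P′ : Sub → Ty → Set} → (∀ {S T} → P S T → P′ ⌊ S ⌋ˢ ⌊ T ⌋ᵀ) →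
           All (Arrow P) S → All (Arrow P′) ⌊ S ⌋ˢ
⌊⌋-Arrow f []             = []
⌊⌋-Arrow f (arrow p ∷ ps) = arrow (f p) ∷ ⌊⌋-Arrow f ps

⌊_⌋ᶜ : Vec Sub n → Vec Sub n
⌊_⌋ᶜ = Vec.map ⌊_⌋ˢ

⌊_⌋ᵏ : Vec Ty m → Vec Ty m
⌊_⌋ᵏ = Vec.map ⌊_⌋ᵀ

infix 4 _⊑_ _⊑ᴶ_

-- The record keeps `M` and `N` visible to unification, whereas `_⊩_∶_∣_` is computed from the term.
record _⊑_ (M N : Term n m) : Set where
  constructor mk⊑
  field ⊑-⊩ : ∀ {Γ Δ T} → Γ ⊩ M ∶ T ∣ Δ → ⌊ Γ ⌋ᶜ ⊩ N ∶ ⌊ T ⌋ᵀ ∣ ⌊ Δ ⌋ᵏ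

record _⊑ᴶ_ (J K : Jump n m) : Set where
  constructor mk⊑ᴶ
  field ⊑ᴶ-⊩ : ∀ {Γ Δ} → Γ ⊩ J ∶⊥∣ Δ → ⌊ Γ ⌋ᶜ ⊩ K ∶⊥∣ ⌊ Δ ⌋ᵏ

open _⊑_
open _⊑ᴶ_

⊑-var : ∀ x → var x ⊑ var {n} {m} x
⊑-var x = mk⊑ λ {Γ} {Δ} {T} p →
  subst (λ S → Any (S ≤ˢ_) ⌊ T ⌋ᵀ) (≡.sym (lookup-map x ⌊_⌋ˢ Γ)) (⌊⌋-≤∈ᵀ p)

⊑-ƛ : ∀ {M M′ : Term (suc n) m} → M ⊑ M′ → ƛ M ⊑ ƛ M′
⊑-ƛ f = mk⊑ (⌊⌋-Any (⌊⌋-Arrow (⊑-⊩ f)))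

⊑-· : ∀ {M M′ N N′ : Term n m} → M ⊑ M′ → N ⊑ N′ → M · N ⊑ M′ · N′
⊑-· {M′ = M′} f g = mk⊑ λ {Γ} {Δ} {T} (Us , p , qs) →
  map ⌊_⌋ᵀ Us , subst (λ U → ⌊ Γ ⌋ᶜ ⊩ M′ ∶ U ∣ ⌊ Δ ⌋ᵏ) (⌊⌋-map-⇛ Us T) (⊑-⊩ f p) ,
  All.map⁺ (All.map (⊑-⊩ g) qs)

⊑-≔ : ∀ {L L′ : Term (suc n) m} {M M′} → L ⊑ L′ → M ⊑ M′ → L ⟨≔ M ⟩ ⊑ L′ ⟨≔ M′ ⟩
⊑-≔ f g = mk⊑ λ (U , p , qs) → ⌊ U ⌋ᵀ , ⊑-⊩ g p , ⌊⌋-All (⊑-⊩ f) qs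

⊑-μ : ∀ {J J′ : Jump n (suc m)} → J ⊑ᴶ J′ → μ J ⊑ μ J′
⊑-μ f = mk⊑ (⊑ᴶ-⊩ f)

⊑-⟦⟧ : ∀ k {M M′ : Term n m} → M ⊑ M′ → ⟦ k ⟧ M ⊑ᴶ ⟦ k ⟧ M′
⊑-⟦⟧ k {M′ = M′} f = mk⊑ᴶ λ {Γ} {Δ} p →
  subst (λ T → ⌊ Γ ⌋ᶜ ⊩ M′ ∶ T ∣ ⌊ Δ ⌋ᵏ) (≡.sym (lookup-map k ⌊_⌋ᵀ Δ)) (⊑-⊩ f p)

⊑-≔ᴶ : ∀ {J J′ : Jump (suc n) m} {M M′} → J ⊑ᴶ J′ → M ⊑ M′ → J ⟨≔ M ⟩ᴶ ⊑ᴶ J′ ⟨≔ M′ ⟩ᴶ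
⊑-≔ᴶ f g = mk⊑ᴶ λ (U , p , qs) → ⌊ U ⌋ᵀ , ⊑-⊩ g p , ⌊⌋-All (⊑ᴶ-⊩ f) qs

-- Subterms beside the expanded redex must survive the replacement of atoms as well; it commutes
-- with every typing clause.
⊑-refl  : ∀ (M : Term n m) → M ⊑ M
⊑-reflᴶ : ∀ (J : Jump n m) → J ⊑ᴶ J

⊑-refl (var x)    = ⊑-var x
⊑-refl (ƛ M)      = ⊑-ƛ (⊑-refl M)
⊑-refl (M · N)    = ⊑-· (⊑-refl M) (⊑-refl N)
⊑-refl (L ⟨≔ M ⟩) = ⊑-≔ (⊑-refl L) (⊑-refl M)
⊑-refl (μ J)      = ⊑-μ (⊑-reflᴶ J)

⊑-reflᴶ (⟦ k ⟧ M)   = ⊑-⟦⟧ k (⊑-refl M)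
⊑-reflᴶ (J ⟨≔ M ⟩ᴶ) = ⊑-≔ᴶ (⊑-reflᴶ J) (⊑-refl M)

-- For rules that expand at unchanged types: the replacement of atoms is applied afterwards, so that
-- all rules fit one relation.
⊩⇒⊑ : ∀ {M N : Term n m} → (∀ {Γ Δ T} → Γ ⊩ M ∶ T ∣ Δ → Γ ⊩ N ∶ T ∣ Δ) → M ⊑ N
⊩⇒⊑ {N = N} f = mk⊑ (λ p → ⊑-⊩ (⊑-refl N) (f p))

⊩⇒⊑ᴶ : ∀ {J K : Jump n m} → (∀ {Γ Δ} → Γ ⊩ J ∶⊥∣ Δ → Γ ⊩ K ∶⊥∣ Δ) → J ⊑ᴶ K
⊩⇒⊑ᴶ {K = K} f = mk⊑ᴶ (λ p → ⊑ᴶ-⊩ (⊑-reflᴶ K) (f p))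

⌊⌋-η : ∀ (V : Term n m) S → Γ ⊩ V ∶ [ ⌊ S ⌋ˢ ] ∣ Δ →
       All (Arrow λ S T → S ∷ Γ ⊩ wk V · var zero ∶ T ∣ Δ) ⌊ S ⌋ˢ
⌊⌋-η V []      p = []
⌊⌋-η V (R ∷ S) p =
  η R (⊩-sub-≤ V (≤ˢ⇒≤ᵀ (here (≤ᴿ-refl _) ∷ [])) p) ∷
  ⌊⌋-η V S (⊩-sub-≤ V (≤ˢ⇒≤ᵀ (⊇⇒≤ˢ there)) p)
  where
  η : ∀ R → Γ ⊩ V ∶ [ [ ⌊ R ⌋ᴿ ] ] ∣ Δ →
      Arrow (λ S T → S ∷ Γ ⊩ wk V · var zero ∶ T ∣ Δ) ⌊ R ⌋ᴿ
  -- The replaced atom is the arrow `[] ⇒ []`; the case split only exposes an arrow in either case.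
  η (atom α) p = arrow (⊩-η V p)
  η (S ⇒ T)  p = arrow (⊩-η V p)

⊑-ηλ : ∀ {V : Term n m} → Value V → V ⊑ ƛ (wk V · var zero)
⊑-ηλ {V = V} v = mk⊑ λ p →
  ⌊⌋-Any (λ {S} q → ⌊⌋-η V S (⊑-⊩ (⊑-refl V) q)) (value-∪⁻ v p)

⟶⇒⊒  : ∀ {M N : Term n m} → M ⟶ N → N ⊑ M
⟶⇒⊒ᴶ : ∀ {J K : Jump n m} → J ⟶ᴶ K → K ⊑ᴶ J

⟶⇒⊒ (ad₁ {N} {M} _)   = ⊩⇒⊑ (⊩-ad₁⁻ N M)
⟶⇒⊒ (ad₂ {N = N} v _) = ⊩⇒⊑ (⊩-ad₂⁻ v N)
⟶⇒⊒ (βλ {M} {V} _)    = ⊩⇒⊑ (⊩-βλ⁻ M V)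
⟶⇒⊒ (βlet {M} v)      = ⊩⇒⊑ (⊩-βlet⁻ v M)
⟶⇒⊒ (βμ {M} {J})      = ⊩⇒⊑ (⊩-βμ⁻ M J)
⟶⇒⊒ (ηλ v)            = ⊑-ηλ v
⟶⇒⊒ (ηlet {M})        = ⊩⇒⊑ (⊩-ηlet⁻ M)
⟶⇒⊒ (ημ {M})          = ⊩⇒⊑ (⊩-wkᶜ M)
⟶⇒⊒ (ξƛ r)            = ⊑-ƛ (⟶⇒⊒ r)
⟶⇒⊒ (ξ·ˡ r)           = ⊑-· (⟶⇒⊒ r) (⊑-refl _)
⟶⇒⊒ (ξ·ʳ r)           = ⊑-· (⊑-refl _) (⟶⇒⊒ r)
⟶⇒⊒ (ξ≔ˡ r)           = ⊑-≔ (⟶⇒⊒ r) (⊑-refl _)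
⟶⇒⊒ (ξ≔ʳ r)           = ⊑-≔ (⊑-refl _) (⟶⇒⊒ r)
⟶⇒⊒ (ξμ r)            = ⊑-μ (⟶⇒⊒ᴶ r)

⟶⇒⊒ᴶ (βjmp {l} {J}) = ⊩⇒⊑ᴶ (⊩-βjmp⁻ J l)
⟶⇒⊒ᴶ (ξjmp {k} r)   = ⊑-⟦⟧ k (⟶⇒⊒ r)
⟶⇒⊒ᴶ (ξ≔ˡ r)        = ⊑-≔ᴶ (⟶⇒⊒ᴶ r) (⊑-refl _)
⟶⇒⊒ᴶ (ξ≔ʳ r)        = ⊑-≔ᴶ (⊑-reflᴶ _) (⟶⇒⊒ r)

-- Reduction sequences

⊩-⟶* : ∀ {L M : Term n m} → L ⟶* M → Γ ⊩ L ∶ T ∣ Δ → Γ ⊩ M ∶ T ∣ Δ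
⊩-⟶* ε            p = p
⊩-⟶* (inj₁ e ◅ r) p = ⊩-⟶* r (⊩-≈ e p)
⊩-⟶* (inj₂ s ◅ r) p = ⊩-⟶* r (⊩-⟶ s p)

-- The tail of the sequence is expanded first. Each reduction step then replaces atoms once, while
-- congruence steps keep contexts and type.
⊩-⟶*⁻ : ∀ {L M : Term n m} → L ⟶* M → Γ ⊩ M ∶ T ∣ Δ →
        ∃[ Γ′ ] ∃[ Δ′ ] ∃[ T′ ] (Γ′ ⊩ L ∶ T′ ∣ Δ′)
⊩-⟶*⁻ ε            p = _ , _ , _ , p
⊩-⟶*⁻ (inj₁ e ◅ r) p = let _ , _ , _ , q = ⊩-⟶*⁻ r p in _ , _ , _ , ⊩-≈˘ e q
⊩-⟶*⁻ (inj₂ s ◅ r) p = let _ , _ , _ , q = ⊩-⟶*⁻ r p in _ , _ , _ , ⊑-⊩ (⟶⇒⊒ s) q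

theorem3p31 : ∀ {n m : ℕ} (L M : Term n m) → L ⟶* M →
    (∀ (Γ : Vec Sub n) (Δ : Vec Ty m) (T : Ty) → Γ ⊢ L ∶ T ∣ Δ → Γ ⊢ M ∶ T ∣ Δ)
    × (∀ (Γ : Vec Sub n) (Δ : Vec Ty m) (T : Ty) → Γ ⊢ M ∶ T ∣ Δ →
    ∃[ Γ′ ] ∃[ Δ′ ] ∃[ T′ ] (Γ′ ⊢ L ∶ T′ ∣ Δ′))
theorem3p31 L M r =
  (λ Γ Δ T p → ⊩⇒⊢ M (⊩-⟶* r (⊢⇒⊩ p))) ,
  (λ Γ Δ T p → let Γ′ , Δ′ , T′ , q = ⊩-⟶*⁻ r (⊢⇒⊩ p) in Γ′ , Δ′ , T′ , ⊩⇒⊢ L q)
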